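{- There is an algorithm that enumerates all Lyndon words of length exactly $n$ over $\Sigma=\{0,\dots,q-1\}$ in lexicographic order, maintaining the current word in compressed representation, such that the amortized number of updates per enumerated word (total number of updates divided by $\ell_n$) is at most $$\frac{3(\Lambda_n-L_n)+\ell_n}{\ell_n}=1+\frac{3q}{(q-1)^2}+o(1)\quad (n\to\infty).$$
   Context: $\Sigma=\{0,1,\dots,q-1\}$ with $0<1<\dots<q-1$ and lexicographic order on words. For $w=w_1\cdots w_n$, $R_i(w)=w_i\cdots w_nw_1\cdots w_{i-1}$; $w$ is a Lyndon word if $w<R_i(w)$ for all $2\le i\le n$. Let $\ell_m$ be the number of Lyndon words of length $m$ over $\Sigma$, $L_m=\ell_1+\cdots+\ell_m$, and $\Lambda_n=L_1+\cdots+L_n$. The compressed representation of $v\in\Sigma^n$ writes $v=v^{(0)}[q-1]^{i_1}v^{(1)}\cdots v^{(t-1)}[q-1]^{i_t}$ with $i_1,\dots,i_{t-1}\ge1$, $i_t\ge 0$ and $v^{(j)}$ nonempty words without the symbol $q-1$, stored as the array/list of cells $v^{(0)},i_1,v^{(1)},\dots,v^{(t-1)},i_t$ (omitting $i_t$ if $0$), each $v^{(j)}$ symbol by symbol and each $i_j$ as one number. An update is a change (modification, insertion or deletion) of one cell of this data structure. -}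

module Defs where

open import Data.Nat as ℕ using (ℕ; zero; suc; _+_; _*_; _∸_; _≤_; _<_; _≤?_; _<?_; _≟_)
open import Data.Fin as Fin using (Fin; toℕ)
open import Data.Fin.Properties as FinP using ()
open import Data.List using (List; []; _∷_; _++_; length; drop; take; filter; map; concatMap; upTo)
open import Data.Nat.ListAction using (sum)
open import Data.List.Relation.Binary.Lex.Strict using (Lex-<; <-decidable)
open import Data.Maybe using (Maybe; just; nothing; _>>=_)
import Data.Maybe as Maybe
open import Data.Bool using (Bool; true; false; if_then_else_)
open import Data.Product using (_×_)
open import Relation.Binary.PropositionalEquality using (_≡_)
open import Relation.Nullary using (Dec; yes; no; does)
open import Relation.Nullary.Decidable using (_→-dec_)
open import Data.Integer using (+_)
open import Data.Rational as ℚ using (ℚ)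

Word : ℕ → Set
Word q = List (Fin q)

_<lex_ : ∀ {q} → Word q → Word q → Set
_<lex_ = Lex-< _≡_ Fin._<_

_<lex?_ : ∀ {q} (u v : Word q) → Dec (u <lex v)
_<lex?_ = <-decidable FinP._≟_ FinP._<?_

-- Rotation R_i(w) = w_i ⋯ w_n w_1 ⋯ w_{i-1}, indexed by k = i - 1.
rot : ∀ {q} → ℕ → Word q → Word q
rot k w = drop k w ++ take k w

Lyndon : ∀ {q} → Word q → Set
Lyndon w = (k : Fin (length w)) → 1 ≤ toℕ k → w <lex rot (toℕ k) w

lyndon? : ∀ {q} (w : Word q) → Dec (Lyndon w)
lyndon? w = FinP.all? (λ k → (1 ≤? toℕ k) →-dec (w <lex? rot (toℕ k) w))

allWords : (q m : ℕ) → List (Word q)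
allWords q zero    = [] ∷ []
allWords q (suc m) = concatMap (λ a → map (a ∷_) (allWords q m)) (Data.List.allFin q)

ℓ : (q m : ℕ) → ℕ
ℓ q m = length (filter lyndon? (allWords q m))

L : (q m : ℕ) → ℕ
L q m = sum (map (λ i → ℓ q (suc i)) (upTo m))

Λ : (q n : ℕ) → ℕ
Λ q n = sum (map (λ i → L q (suc i)) (upTo n))

-- A cell is either one symbol (of some v^(j)) or one run-length number i_j.
data Cell (q : ℕ) : Set where
  sym : Fin q → Cell q
  num : ℕ → Cell q

isTop : ∀ {q} → Fin q → Bool
isTop {q} a = does (suc (toℕ a) ≟ q)

flush : ∀ {q} → ℕ → List (Cell q)
flush zero    = []
flush (suc k) = num (suc k) ∷ []

-- k = number of pending (q-1)-symbols not yet emitted as a run count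
compressFrom : ∀ {q} → ℕ → Word q → List (Cell q)
compressFrom k []      = flush k
compressFrom k (a ∷ w) =
  if isTop a then compressFrom (suc k) w
             else flush k ++ (sym a ∷ compressFrom zero w)

compress : ∀ {q} → Word q → List (Cell q)
compress = compressFrom zero

data Update (q : ℕ) : Set where
  modify : ℕ → Cell q → Update q
  insert : ℕ → Cell q → Update q
  delete : ℕ → Update q

modifyAt : ∀ {q} → ℕ → Cell q → List (Cell q) → Maybe (List (Cell q))
modifyAt i       c []       = nothing
modifyAt zero    c (x ∷ xs) = just (c ∷ xs)
modifyAt (suc i) c (x ∷ xs) = Maybe.map (x ∷_) (modifyAt i c xs)

insertAt : ∀ {q} → ℕ → Cell q → List (Cell q) → Maybe (List (Cell q))
insertAt zero    c xs       = just (c ∷ xs)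
insertAt (suc i) c []       = nothing
insertAt (suc i) c (x ∷ xs) = Maybe.map (x ∷_) (insertAt i c xs)

deleteAt : ∀ {q} → ℕ → List (Cell q) → Maybe (List (Cell q))
deleteAt i       []       = nothing
deleteAt zero    (x ∷ xs) = just xs
deleteAt (suc i) (x ∷ xs) = Maybe.map (x ∷_) (deleteAt i xs)

applyUpdate : ∀ {q} → Update q → List (Cell q) → Maybe (List (Cell q))
applyUpdate (modify i c) = modifyAt i c
applyUpdate (insert i c) = insertAt i c
applyUpdate (delete i)   = deleteAt i

applyUpdates : ∀ {q} → List (Update q) → List (Cell q) → Maybe (List (Cell q))
applyUpdates []       xs = just xs
applyUpdates (u ∷ us) xs = applyUpdate u xs >>= applyUpdates us

data Steps {q : ℕ} : List (Word q) → List (List (Update q)) → Set where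
  none   : Steps [] []
  single : ∀ w → Steps (w ∷ []) []
  step   : ∀ {w w' ws us u} →
           applyUpdates u (compress w) ≡ just (compress w') →
           Steps (w' ∷ ws) us → Steps (w ∷ w' ∷ ws) (u ∷ us)

totalUpdates : ∀ {q} → List (List (Update q)) → ℕ
totalUpdates us = sum (map length us)

bound : (q n : ℕ) → ℕ
bound q n = 3 * (Λ q n ∸ L q n) + ℓ q n

-- a / b as a rational number (with the convention a / 0 = 0; only used with b > 0)
frac : ℕ → ℕ → ℚ
frac a zero    = ℚ.0ℚ
frac a (suc b) = (+ a) ℚ./ suc b

{-# OPTIONS --safe #-}
module Submission where

-- Let w < w′ be consecutive Lyndon words of length n and write w = p a s, w′ = p b t with
-- a < b.  Then s is a run of the letter q - 1, since w could be increased otherwise, and x = p b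
-- is a Lyndon word with w < x ≤ w′.  Turning w into w′ costs at most 3 (n - |x|) + 1 updates,
-- amortized, and different pairs have different x.  The sum of n - |x| over the Lyndon words x
-- of length at most n is Λ_n - L_n.
--
-- A word of length m is a rotation of a Lyndon word or is fixed by a rotation by at most m / 2
-- places, so m ℓ_m ≤ q^m ≤ m ℓ_m + m q^⌊m/2⌋.  Hence ℓ_{m+1} ~ q ℓ_m.  If a_{n+1} ~ q a_n, then
-- the partial sums S_n = a_0 + ⋯ + a_{n-1} satisfy S_{n+1} ~ q S_n and a_n ~ (q - 1) S_n.
-- Two applications give (q - 1)² Λ_n ~ q ℓ_{n+1}.

open import Defs
open import Data.Bool using (false; if_then_else_; true)
open import Data.Empty using (⊥-elim)
open import Data.Fin as Fin using (Fin; fromℕ<; toℕ)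
import Data.Fin.Properties as Fin
open import Data.Integer as ℤ using (ℤ)
import Data.Integer.Properties as ℤ
open import Data.List using (List; []; _++_; _∷_; allFin; cartesianProduct; cartesianProductWith; concat; concatMap; drop; filter; length; map; replicate; take; upTo)
open import Data.List.Membership.Propositional using (_∈_)
open import Data.List.Membership.Propositional.Properties using (∈-++⁺ʳ; ∈-++⁺ˡ; ∈-++⁻; ∈-allFin; ∈-cartesianProductWith⁺; ∈-cartesianProduct⁺; ∈-cartesianProduct⁻; ∈-concat⁺′; ∈-filter⁺; ∈-map⁺; ∈-map⁻; ∈-upTo⁺; ∈-upTo⁻; ∈-∃++)
open import Data.List.Properties using (++-assoc; ++-identityʳ; length-++; length-drop; length-map; length-replicate; length-tabulate; length-take; length-upTo; map-++; take++drop≡id; take-take; upTo-∷ʳ; ∷-injective)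
open import Data.List.Relation.Binary.Lex.Strict using (<-asymmetric; <-compare; <-transitive; base; halt; next; this)
open import Data.List.Relation.Binary.Pointwise using (Pointwise-≡⇒≡)
open import Data.List.Relation.Unary.All as All using (All; []; _∷_)
import Data.List.Relation.Unary.All.Properties as All
open import Data.List.Relation.Unary.AllPairs as AllPairs using (AllPairs; []; _∷_)
import Data.List.Relation.Unary.AllPairs.Properties as AllPairs
open import Data.List.Relation.Unary.Any using (here; there)
open import Data.List.Relation.Unary.Linked using (Linked)
import Data.List.Relation.Unary.Linked.Properties as Linked
open import Data.List.Relation.Unary.Unique.Propositional using (Unique)
open import Data.List.Relation.Unary.Unique.Propositional.Properties using (cartesianProduct⁺; upTo⁺)
open import Data.Maybe as Maybe using (_>>=_; just)
open import Data.Nat using (_*_; _^_; _∸_; _≟_; _≤?_; _≤_; _⊓_; _⊔_; suc; s≤s; zero; z≤n; ℕ; ⌈_/2⌉; ⌊_/2⌋)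
open import Data.Nat.ListAction using (sum)
open import Data.Nat.ListAction.Properties using (sum-++)
open import Data.Nat.Properties
open import Data.Nat.Solver using (module +-*-Solver)
open import Data.Product using (_,_; _×_; proj₁; proj₂; Σ; ∃; ∃₂)
open import Data.Rational as ℚ using (0ℚ; 1ℚ; mkℚ; toℚᵘ; ℚ)
import Data.Rational.Properties as ℚ
open import Data.Rational.Unnormalised as ℚᵘ using (*<*; *≡*; _≃_; mkℚᵘ)
import Data.Rational.Unnormalised.Properties as ℚᵘ
open import Data.Sum using (_⊎_; inj₁; inj₂)
open import Function using (_∘_; const)
open import Relation.Binary using (tri<; tri>; tri≈)
open import Relation.Binary.PropositionalEquality as ≡ using (_≡_; cong; cong₂; refl; subst; subst₂; trans)
open import Relation.Nullary using (contradiction; no; yes; ¬_)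
open import Relation.Nullary.Decidable using (_→-dec_; dec-false; dec-true)

-- The bound grants one update per word and three for every letter of w′ beyond x = p b. A step with
-- s and t empty therefore has to cost one update, yet it costs two when b = q - 1 joins a run at
-- the end of p: the cell of a disappears and the run number changes. Such a step leads from a word
-- that does not end in q - 1 to one that does, so ending in q - 1 is taken as a potential with
-- values 0 and 1. Its final value is paid by the spare unit of the bound, since ℓ_n words have only
-- ℓ_n - 1 steps between them. The inequalities w < x ≤ w′ put the words x in strictly increasing
-- order, so each Lyndon word of length at most n is charged at most once. The asymptotics stay
-- within ℕ, where f ~ g means that K |f - g| ≤ g eventually, for every K; rationals enter only in
-- the last estimate.

module Enumeration where

  open import Data.Nat using (_+_; _<_)

  private variable
    q : ℕ
    a b c : Fin q
    u v w w′ : Word q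

  -- The lexicographic order and first differences

  <lex-trans : u <lex v → v <lex w → u <lex w
  <lex-trans = <-transitive ≡.isEquivalence (≡.resp₂ Fin._<_) Fin.<-trans

  <lex-asym : u <lex v → ¬ v <lex u
  <lex-asym = <-asymmetric ≡.sym (≡.resp₂ Fin._<_) Fin.<-asym

  <lex-irrefl : ¬ w <lex w
  <lex-irrefl w<w = <lex-asym w<w w<w

  ≮lex-antisym : ¬ u <lex v → ¬ v <lex u → u ≡ v
  ≮lex-antisym {u = u} {v} u≮v v≮u with <-compare ≡.sym Fin.<-cmp u v
  ... | tri< u<v _ _ = contradiction u<v u≮v
  ... | tri≈ _ u≡v _ = Pointwise-≡⇒≡ u≡v
  ... | tri> _ _ v<u = contradiction v<u v≮u

  ++-monoʳ-<lex : ∀ (p : Word q) → u <lex v → (p ++ u) <lex (p ++ v)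
  ++-monoʳ-<lex []      u<v = u<v
  ++-monoʳ-<lex (_ ∷ p) u<v = next refl (++-monoʳ-<lex p u<v)

  ++-<lex : ∀ (u : Word q) → (u ++ v) <lex w → u <lex w
  ++-<lex []      halt          = halt
  ++-<lex []      (this _)      = halt
  ++-<lex []      (next _ _)    = halt
  ++-<lex (_ ∷ u) (this a<b)    = this a<b
  ++-<lex (_ ∷ u) (next a≡b lt) = next a≡b (++-<lex u lt)

  data Diverge {q} : Word q → Word q → Set where
    diverge : ∀ p s t → a Fin.< b → Diverge (p ++ a ∷ s) (p ++ b ∷ t)

  -- Equal lengths exclude that `u` is a proper prefix of `v`, so the order is decided by a letter.
  <lex⇒Diverge : length u ≡ length v → u <lex v → Diverge u v
  <lex⇒Diverge _   (this a<b)      = diverge [] _ _ a<b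
  <lex⇒Diverge len (next refl u<v) with <lex⇒Diverge (suc-injective len) u<v
  ... | diverge p s t a<b = diverge (_ ∷ p) s t a<b

  -- Lyndon words and raising a letter

  drop-length-++ : ∀ {A : Set} (xs ys : List A) → drop (length xs) (xs ++ ys) ≡ ys
  drop-length-++ []       ys = refl
  drop-length-++ (_ ∷ xs) ys = drop-length-++ xs ys

  take-length-++ : ∀ {A : Set} (xs ys : List A) → take (length xs) (xs ++ ys) ≡ xs
  take-length-++ []       ys = refl
  take-length-++ (x ∷ xs) ys = cong (x ∷_) (take-length-++ xs ys)

  rot-length-++ : ∀ (u v : Word q) → rot (length u) (u ++ v) ≡ v ++ u
  rot-length-++ u v = cong₂ _++_ (drop-length-++ u v) (take-length-++ u v)

  Lyndon⇒< : ∀ (u v : Word q) → 1 ≤ length u → 1 ≤ length v →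
             Lyndon (u ++ v) → (u ++ v) <lex (v ++ u)
  Lyndon⇒< u v 1≤u 1≤v lyn =
    subst ((u ++ v) <lex_) (trans (cong (λ k → rot k (u ++ v)) k≡) (rot-length-++ u v))
      (lyn (fromℕ< lt) (subst (1 ≤_) (≡.sym k≡) 1≤u))
    where
    lt : length u < length (u ++ v)
    lt = subst (length u <_) (≡.sym (length-++ u)) (m<m+n (length u) 1≤v)
    k≡ : toℕ (fromℕ< lt) ≡ length u
    k≡ = Fin.toℕ-fromℕ< lt

  <⇒Lyndon : (∀ u v → w ≡ u ++ v → 1 ≤ length u → 1 ≤ length v → w <lex (v ++ u)) → Lyndon w
  <⇒Lyndon {w = w} h k 1≤k = h (take (toℕ k) w) (drop (toℕ k) w) (≡.sym (take++drop≡id (toℕ k) w))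
    (subst (1 ≤_) (≡.sym (trans (length-take (toℕ k) w) (m≤n⇒m⊓n≡m (<⇒≤ (Fin.toℕ<n k))))) 1≤k)
    (subst (1 ≤_) (≡.sym (length-drop (toℕ k) w)) (m<n⇒0<n∸m (Fin.toℕ<n k)))

  ++-split : ∀ (p u : Word q) {b e v} → p ++ b ∷ e ≡ u ++ v →
             (∃ λ v′ → p ≡ u ++ v′ × v ≡ v′ ++ b ∷ e) ⊎ (∃ λ e₁ → u ≡ p ++ b ∷ e₁ × e ≡ e₁ ++ v)
  ++-split p       []      refl = inj₁ (p , refl , refl)
  ++-split []      (_ ∷ u) refl = inj₂ (u , refl , refl)
  ++-split (x ∷ p) (y ∷ u) eq with ∷-injective eq
  ... | refl , eq′ with ++-split p u eq′
  ...   | inj₁ (v′ , refl , refl) = inj₁ (v′ , refl , refl)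
  ...   | inj₂ (e₁ , refl , refl) = inj₂ (e₁ , refl , refl)

  -- As `v` is shorter than `y`, the comparison never gets past the position of `a`. A difference
  -- inside `v` persists; otherwise the letter of `y` facing `a` is at most `a`, hence below `b`.
  -- The tails are therefore arbitrary.
  raise-<lex : ∀ (y v : Word q) {r z r′ z′} → length v < length y → a Fin.< b →
               (y ++ r) <lex (v ++ a ∷ z) → (y ++ r′) <lex (v ++ b ∷ z′)
  raise-<lex (_ ∷ y) []      _         a<b (this y<a)      = this (Fin.<-trans y<a a<b)
  raise-<lex (_ ∷ y) []      _         a<b (next refl _)   = this a<b
  raise-<lex (_ ∷ y) (_ ∷ v) _         a<b (this y<c)      = this y<c
  raise-<lex (_ ∷ y) (_ ∷ v) (s≤s v<y) a<b (next refl lt)  = next refl (raise-<lex y v v<y a<b lt)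

  -- Comparison with a one-letter word can succeed only at the first letter. The hypothesis thus
  -- says that the first letter of `p ++ b ∷ []` is below `c`, in a form that also covers an empty
  -- `p`.
  first-<lex : ∀ (p : Word q) {e z} → (p ++ b ∷ []) <lex (c ∷ []) → (p ++ b ∷ e) <lex (c ∷ z)
  first-<lex []      (this b<c)    = this b<c
  first-<lex []      (next _ (base ()))
  first-<lex (_ ∷ p) (this a<c)    = this a<c
  first-<lex (_ ∷ []) (next _ ())
  first-<lex (_ ∷ _ ∷ _) (next _ ())

  -- A proper rotation of p b e starts either inside p b, where it is larger than the
  -- corresponding rotation of p a s, or with a letter of e.
  Lyndon-raise : ∀ (p : Word q) {s e} → Lyndon (p ++ a ∷ s) → a Fin.< b →
                 All (λ c → (p ++ b ∷ []) <lex (c ∷ [])) e → Lyndon (p ++ b ∷ e)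
  Lyndon-raise {a = a} {b} p {s} {e} lyn a<b big = <⇒Lyndon λ u v eq 1≤u 1≤v → go u v eq 1≤u 1≤v (++-split p u eq)
    where
    go : ∀ u v → p ++ b ∷ e ≡ u ++ v → 1 ≤ length u → 1 ≤ length v →
         (∃ λ v′ → p ≡ u ++ v′ × v ≡ v′ ++ b ∷ e) ⊎ (∃ λ e₁ → u ≡ p ++ b ∷ e₁ × e ≡ e₁ ++ v) →
         (p ++ b ∷ e) <lex (v ++ u)
    go u v eq 1≤u 1≤v (inj₁ (v′ , refl , refl)) =
      subst ((p ++ b ∷ e) <lex_) (≡.sym (++-assoc v′ (b ∷ e) u))
        (raise-<lex p v′ (subst (length v′ <_) (≡.sym (length-++ u)) (m<n+m (length v′) 1≤u)) a<b
          (subst₂ _<lex_ (≡.sym (++-assoc u v′ (a ∷ s))) (++-assoc v′ (a ∷ s) u)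
            (Lyndon⇒< u (v′ ++ a ∷ s) 1≤u
              (subst (1 ≤_) (≡.sym (length-++ v′)) (≤-trans (s≤s z≤n) (m≤n+m _ (length v′))))
              (subst Lyndon (++-assoc u v′ (a ∷ s)) lyn))))
    go u (c ∷ v) eq 1≤u 1≤v (inj₂ (e₁ , refl , refl)) = first-<lex p (All.head (All.++⁻ʳ e₁ big))

  -- As `p` is nonempty, comparing the word with its rotation that starts at `c` shows that its
  -- first letter is at most `c`. The successor `c′` exceeds that letter, so a tail made of copies
  -- of `c′` satisfies the condition of `Lyndon-raise`.
  Lyndon-increase : ∀ (p : Word q) {c z} → 1 ≤ length p → Lyndon (p ++ c ∷ z) → suc (toℕ c) < q →
    ∃₂ λ c′ z′ → c Fin.< c′ × length z′ ≡ length z × Lyndon (p ++ c′ ∷ z′)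
  Lyndon-increase (x ∷ p) {c} {z} _ lyn c+1<q =
    c′ , replicate (length z) c′ , c<c′ , length-replicate (length z) ,
    Lyndon-raise (x ∷ p) lyn c<c′ (All.replicate⁺ (length z) (x<c′ (Lyndon⇒< (x ∷ p) (c ∷ z) (s≤s z≤n) (s≤s z≤n) lyn)))
    where
    c′ = fromℕ< c+1<q
    c<c′ : c Fin.< c′
    c<c′ = subst (toℕ c <_) (≡.sym (Fin.toℕ-fromℕ< c+1<q)) ≤-refl
    x<c′ : ∀ {r r′} → (x ∷ r) <lex (c ∷ r′) → (x ∷ p ++ c′ ∷ []) <lex (c′ ∷ [])
    x<c′ (this x<c)    = this (Fin.<-trans x<c c<c′)
    x<c′ (next refl _) = this c<c′

  -- The largest letter

  Top : Fin q → Set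
  Top {q} a = suc (toℕ a) ≡ q

  top-or-less : (a : Fin q) → Top a ⊎ suc (toℕ a) < q
  top-or-less a with m≤n⇒m<n∨m≡n (Fin.toℕ<n a)
  ... | inj₁ lt = inj₂ lt
  ... | inj₂ eq = inj₁ eq

  tops-or-less : (s : Word q) → All Top s ⊎ (∃ λ g → ∃₂ λ c z → s ≡ g ++ c ∷ z × suc (toℕ c) < q)
  tops-or-less []      = inj₁ []
  tops-or-less (a ∷ s) with top-or-less a | tops-or-less s
  ... | inj₂ lt  | _        = inj₂ ([] , a , s , refl , lt)
  ... | inj₁ top | inj₁ all = inj₁ (top ∷ all)
  ... | inj₁ top | inj₂ (g , c , z , refl , lt) = inj₂ (a ∷ g , c , z , refl , lt)

  isTop-yes : Top a → isTop a ≡ true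
  isTop-yes {q} {a} = dec-true (suc (toℕ a) ≟ q)

  isTop-no : ∀ {a b : Fin q} → a Fin.< b → isTop a ≡ false
  isTop-no {q} {a} {b} a<b = dec-false (suc (toℕ a) ≟ q)
    λ top → contradiction (Fin.toℕ<n b) (≤⇒≯ (subst (_≤ toℕ b) top a<b))

  isTop-cases : (a : Fin q) → isTop a ≡ true ⊎ isTop a ≡ false
  isTop-cases a with isTop a
  ... | true  = inj₁ refl
  ... | false = inj₂ refl

  -- Edit distance of cell lists

  Edit : List (Cell q) → List (Cell q) → ℕ → Set
  Edit xs ys k = ∃ λ us → length us ≡ k × applyUpdates us xs ≡ just ys

  shift : Update q → Update q
  shift (modify i c) = modify (suc i) c
  shift (insert i c) = insert (suc i) c
  shift (delete i)   = delete (suc i)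

  applyUpdate-shift : ∀ (u : Update q) x xs →
    applyUpdate (shift u) (x ∷ xs) ≡ Maybe.map (x ∷_) (applyUpdate u xs)
  applyUpdate-shift (modify i c) x xs = refl
  applyUpdate-shift (insert i c) x xs = refl
  applyUpdate-shift (delete i)   x xs = refl

  applyUpdates-shift : ∀ (us : List (Update q)) x xs →
    applyUpdates (map shift us) (x ∷ xs) ≡ Maybe.map (x ∷_) (applyUpdates us xs)
  applyUpdates-shift []       x xs = refl
  applyUpdates-shift (u ∷ us) x xs rewrite applyUpdate-shift u x xs with applyUpdate u xs
  ... | Maybe.nothing = refl
  ... | just ys = applyUpdates-shift us x ys

  Edit-∷ : ∀ (x : Cell q) {xs ys k} → Edit xs ys k → Edit (x ∷ xs) (x ∷ ys) k
  Edit-∷ x {xs} (us , len , eq) = map shift us , trans (length-map shift us) len ,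
    trans (applyUpdates-shift us x xs) (cong (Maybe.map (x ∷_)) eq)

  Edit-++ : ∀ (cs : List (Cell q)) {xs ys k} → Edit xs ys k → Edit (cs ++ xs) (cs ++ ys) k
  Edit-++ []       e = e
  Edit-++ (c ∷ cs) e = Edit-∷ c (Edit-++ cs e)

  Edit-step : ∀ (u : Update q) {xs ys zs k} → applyUpdate u xs ≡ just ys → Edit ys zs k → Edit xs zs (suc k)
  Edit-step u {zs = zs} eq (us , len , eq′) =
    u ∷ us , cong suc len , trans (cong (_>>= applyUpdates us) eq) eq′

  -- Cells at equal positions cost one modification each, and only the surplus of the longer list is
  -- inserted or deleted; hence the maximum of the lengths rather than their sum.
  Edit-replace : ∀ (xs ys : List (Cell q)) → Edit xs ys (length xs ⊔ length ys)
  Edit-replace []       []       = [] , refl , refl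
  Edit-replace []       (y ∷ ys) = Edit-step (insert 0 y) refl (Edit-∷ y (Edit-replace [] ys))
  Edit-replace (x ∷ xs) []       =
    subst (Edit (x ∷ xs) []) (cong suc (⊔-identityʳ (length xs))) (Edit-step (delete 0) refl (Edit-replace xs []))
  Edit-replace (x ∷ xs) (y ∷ ys) = Edit-step (modify 0 y) refl (Edit-∷ y (Edit-replace xs ys))

  -- Compressed representations

  compressFrom-top : ∀ k (w : Word q) → isTop a ≡ true → compressFrom k (a ∷ w) ≡ compressFrom (suc k) w
  compressFrom-top k w eq rewrite eq = refl

  compressFrom-nontop : ∀ k (w : Word q) → isTop a ≡ false → compressFrom k (a ∷ w) ≡ flush k ++ sym a ∷ compressFrom 0 w
  compressFrom-nontop k w eq rewrite eq = refl

  -- A common prefix fixes the cells `cs` and leaves just a pending run of length `k′`, whatever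
  -- follows. Edits can be confined to the cells after `cs`, but the number of the pending run is
  -- among those.
  compressFrom-++ : ∀ k (p : Word q) → ∃₂ λ cs k′ → ∀ z → compressFrom k (p ++ z) ≡ cs ++ compressFrom k′ z
  compressFrom-++ k []      = [] , k , λ z → refl
  compressFrom-++ k (a ∷ p) with isTop-cases a
  ... | inj₁ top with compressFrom-++ (suc k) p
  ...   | cs , k′ , eq = cs , k′ , λ z → trans (compressFrom-top k (p ++ z) top) (eq z)
  compressFrom-++ k (a ∷ p) | inj₂ nontop with compressFrom-++ 0 p
  ...   | cs , k′ , eq = flush k ++ sym a ∷ cs , k′ , λ z →
    trans (compressFrom-nontop k (p ++ z) nontop)
      (trans (cong (λ r → flush k ++ sym a ∷ r) (eq z)) (≡.sym (++-assoc (flush k) (sym a ∷ cs) _)))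

  compressFrom-tops : ∀ k {s : Word q} → All Top s → compressFrom k s ≡ flush (k + length s)
  compressFrom-tops k []           = cong flush (≡.sym (+-identityʳ k))
  compressFrom-tops k {a ∷ s} (top ∷ tops) = trans (compressFrom-top k s (isTop-yes top))
    (trans (compressFrom-tops (suc k) tops) (cong flush (≡.sym (+-suc k (length s)))))

  length-flush : ∀ k → length (flush {q} k) ≤ 1
  length-flush zero    = z≤n
  length-flush (suc k) = s≤s z≤n

  length-compressFrom : ∀ k (w : Word q) → length (compressFrom k w) ≤ length (flush {q} k) + length w
  length-compressFrom k []      = ≤-reflexive (≡.sym (+-identityʳ _))
  length-compressFrom {q} k (a ∷ w) with isTop-cases a
  ... | inj₁ top rewrite compressFrom-top k w top =
    ≤-trans (length-compressFrom (suc k) w) (m≤n+m (suc (length w)) (length (flush {q} k)))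
  ... | inj₂ nontop rewrite compressFrom-nontop k w nontop | length-++ (flush k) {sym a ∷ compressFrom 0 w} =
    +-monoʳ-≤ (length (flush {q} k)) (s≤s (length-compressFrom 0 w))

  endsInTop : Word q → ℕ
  endsInTop []          = 0
  endsInTop (a ∷ [])    = if isTop a then 1 else 0
  endsInTop (_ ∷ b ∷ w) = endsInTop (b ∷ w)

  endsInTop≤1 : ∀ (w : Word q) → endsInTop w ≤ 1
  endsInTop≤1 []          = z≤n
  endsInTop≤1 (a ∷ [])    with isTop a
  ... | true  = ≤-refl
  ... | false = z≤n
  endsInTop≤1 (_ ∷ b ∷ w) = endsInTop≤1 (b ∷ w)

  endsInTop-∷ʳ : ∀ (p : Word q) → endsInTop (p ++ a ∷ []) ≡ endsInTop (a ∷ [])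
  endsInTop-∷ʳ []          = refl
  endsInTop-∷ʳ (_ ∷ [])    = refl
  endsInTop-∷ʳ (_ ∷ x ∷ p) = endsInTop-∷ʳ (x ∷ p)

  -- The potential endsInTop pays for the case p a ↦ p b in which b = q - 1 is merged into
  -- a run at the end of p, the only single-letter change that needs two updates.
  edit-cost : ∀ (p : Word q) {s t} → a Fin.< b → All Top s → length s ≡ length t →
    ∃ λ k → Edit (compress (p ++ a ∷ s)) (compress (p ++ b ∷ t)) k ×
            k + endsInTop (p ++ a ∷ s) ≤ 3 * length t + 1 + endsInTop (p ++ b ∷ t)
  edit-cost {q} {a} {b} p {s} {t} a<b tops len with compressFrom-++ 0 p
  ... | cs , k , eq = go s t tops len
    where
    source : ∀ {s} → All Top s → compressFrom k (a ∷ s) ≡ flush k ++ sym a ∷ flush (length s)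
    source {s} tops = trans (compressFrom-nontop k s (isTop-no a<b))
      (cong (λ r → flush k ++ sym a ∷ r) (compressFrom-tops 0 tops))
    length-source : ∀ {s} → All Top s → length (compressFrom k (a ∷ s)) ≤ 2 + length (flush {q} (length s))
    length-source {s} tops rewrite source tops | length-++ (flush k) {sym a ∷ flush (length s)} =
      +-monoˡ-≤ (suc (length (flush {q} (length s)))) (length-flush {q} k)
    rewriting : ∀ {s t n} → Edit (compressFrom k (a ∷ s)) (compressFrom k (b ∷ t)) n →
                Edit (compress (p ++ a ∷ s)) (compress (p ++ b ∷ t)) n
    rewriting {s} {t} {n} e = subst₂ (λ xs ys → Edit xs ys n) (≡.sym (eq (a ∷ s))) (≡.sym (eq (b ∷ t))) (Edit-++ cs e)
    go : ∀ s t → All Top s → length s ≡ length t →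
      ∃ λ n → Edit (compress (p ++ a ∷ s)) (compress (p ++ b ∷ t)) n ×
              n + endsInTop (p ++ a ∷ s) ≤ 3 * length t + 1 + endsInTop (p ++ b ∷ t)
    go [] [] _ _ rewrite endsInTop-∷ʳ {a = a} p | endsInTop-∷ʳ {a = b} p | isTop-no a<b with isTop-cases b
    ... | inj₁ top rewrite top = _ , rewriting (Edit-replace (compressFrom k (a ∷ [])) (compressFrom k (b ∷ []))) ,
      subst (_≤ 2) (≡.sym (+-identityʳ _)) (⊔-lub (length-source [])
        (≤-trans (length-compressFrom k (b ∷ [])) (+-monoˡ-≤ 1 (length-flush {q} k))))
    ... | inj₂ nontop rewrite nontop = 1 , rewriting
      (subst₂ (λ xs ys → Edit xs ys 1) (≡.sym (source [])) (≡.sym (compressFrom-nontop k [] nontop))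
        (Edit-++ (flush k) (Edit-replace (sym a ∷ []) (sym b ∷ [])))) , ≤-refl
    -- The factor 3 arises here: the old tail has at most three cells (pending run, `a`, final run),
    -- the new one at most two more than the length of `d ∷ t`, and both are at most three times
    -- that length once it is positive. The summand 1 covers the old potential.
    go (c ∷ s) (d ∷ t) tops len = _ , rewriting (Edit-replace (compressFrom k (a ∷ c ∷ s)) (compressFrom k (b ∷ d ∷ t))) ,
      ≤-trans (+-mono-≤ (⊔-lub
          (≤-trans (length-source tops) (m≤m*n 3 (suc (length t))))
          (≤-trans (length-compressFrom k (b ∷ d ∷ t)) (≤-trans (+-monoˡ-≤ _ (length-flush {q} k))
            (subst (3 + length t ≤_) (≡.sym (*-suc 3 (length t))) (+-monoʳ-≤ 3 (m≤n*m (length t) 3))))))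
        (endsInTop≤1 (p ++ a ∷ c ∷ s)))
        (m≤m+n _ _)

  -- Words and Lyndon words of a given length

  allWords-length : ∀ m → All (λ w → length w ≡ m) (allWords q m)
  allWords-length zero    = refl ∷ []
  allWords-length {q} (suc m) =
    All.concat⁺ (All.map⁺ (All.universal (λ a → All.map⁺ (All.map (cong suc) (allWords-length m))) (allFin q)))

  ∈-allWords : (w : Word q) → w ∈ allWords q (length w)
  ∈-allWords []      = here refl
  ∈-allWords (a ∷ w) = ∈-concat⁺′ (∈-map⁺ (a ∷_) (∈-allWords w))
    (∈-map⁺ (λ a → map (a ∷_) (allWords _ (length w))) (∈-allFin a))

  allWords-sorted : ∀ m → AllPairs _<lex_ (allWords q m)
  allWords-sorted zero    = [] ∷ []
  allWords-sorted {q} (suc m) = AllPairs.concat⁺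
    (All.map⁺ (All.universal (λ a → AllPairs.map⁺ (AllPairs.map (next refl) (allWords-sorted m))) (allFin q)))
    (AllPairs.map⁺ (AllPairs.tabulate⁺-< λ a<b →
      All.map⁺ (All.universal (λ _ → All.map⁺ (All.universal (λ _ → this a<b) _)) _)))

  lyndons : (q m : ℕ) → List (Word q)
  lyndons q m = filter lyndon? (allWords q m)

  ∈-lyndons : Lyndon w → w ∈ lyndons q (length w)
  ∈-lyndons {w = w} lyn = ∈-filter⁺ lyndon? (∈-allWords w) lyn

  lyndons-sound : ∀ m → All (λ w → length w ≡ m × Lyndon w) (lyndons q m)
  lyndons-sound {q} m = All.zip (All.filter⁺ lyndon? (allWords-length m) , All.all-filter lyndon? (allWords q m))

  lyndons-sorted : ∀ m → AllPairs _<lex_ (lyndons q m)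
  lyndons-sorted m = AllPairs.filter⁺ lyndon? (allWords-sorted m)

  lyndonsUpTo : (q n : ℕ) → List (Word q)
  lyndonsUpTo q zero    = []
  lyndonsUpTo q (suc n) = lyndonsUpTo q n ++ lyndons q (suc n)

  ∈-lyndonsUpTo : ∀ {n} → Lyndon w → 1 ≤ length w → length w ≤ n → w ∈ lyndonsUpTo q n
  ∈-lyndonsUpTo {w = []} {n = zero} lyn () z≤n
  ∈-lyndonsUpTo {q} {w = w} {n = suc n} lyn 1≤w w≤n with m≤n⇒m<n∨m≡n w≤n
  ... | inj₁ w<1+n = ∈-++⁺ˡ (∈-lyndonsUpTo lyn 1≤w (≤-pred w<1+n))
  ... | inj₂ w≡1+n = ∈-++⁺ʳ (lyndonsUpTo q n) (subst (λ m → w ∈ lyndons q m) w≡1+n (∈-lyndons lyn))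

  -- One occurrence of `x` is cut out of `ys`; since `x` does not recur in `xs`, the other entries
  -- survive in what is left. With the deficit as weight this bounds the total cost, with weight 1
  -- it compares lengths.
  sum-⊆ : ∀ {A : Set} (f : A → ℕ) {xs ys} → Unique xs → (∀ {x} → x ∈ xs → x ∈ ys) →
          sum (map f xs) ≤ sum (map f ys)
  sum-⊆ f [] sub = z≤n
  sum-⊆ f {x ∷ xs} {ys} (x∉xs ∷ xs!) sub with ∈-∃++ (sub (here refl))
  ... | ys₁ , ys₂ , refl = begin
    f x + sum (map f xs)                        ≤⟨ +-monoʳ-≤ (f x) (sum-⊆ f xs! sub′) ⟩
    f x + sum (map f (ys₁ ++ ys₂))              ≡⟨ cong (f x +_) (sum-map-++ ys₁ ys₂) ⟩
    f x + (sum (map f ys₁) + sum (map f ys₂))   ≡⟨ +-assoc (f x) _ _ ⟨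
    f x + sum (map f ys₁) + sum (map f ys₂)     ≡⟨ cong (_+ sum (map f ys₂)) (+-comm (f x) _) ⟩
    sum (map f ys₁) + f x + sum (map f ys₂)     ≡⟨ +-assoc (sum (map f ys₁)) _ _ ⟩
    sum (map f ys₁) + (f x + sum (map f ys₂))   ≡⟨ sum-map-++ ys₁ (x ∷ ys₂) ⟨
    sum (map f (ys₁ ++ x ∷ ys₂))                ∎
    where
    open ≤-Reasoning
    sum-map-++ : ∀ xs ys → sum (map f (xs ++ ys)) ≡ sum (map f xs) + sum (map f ys)
    sum-map-++ xs ys = trans (cong sum (map-++ f xs ys)) (sum-++ (map f xs) (map f ys))
    sub′ : ∀ {y} → y ∈ xs → y ∈ ys₁ ++ ys₂
    sub′ y∈xs with ∈-++⁻ ys₁ (sub (there y∈xs))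
    ... | inj₁ y∈ys₁         = ∈-++⁺ˡ y∈ys₁
    ... | inj₂ (here refl)   = contradiction refl (All.lookup x∉xs y∈xs)
    ... | inj₂ (there y∈ys₂) = ∈-++⁺ʳ ys₁ y∈ys₂

  sum-upTo-suc : ∀ (f : ℕ → ℕ) n → sum (map f (upTo (suc n))) ≡ sum (map f (upTo n)) + f n
  sum-upTo-suc f n = trans (cong (sum ∘ map f) (≡.sym (upTo-∷ʳ n)))
    (trans (cong sum (map-++ f (upTo n) (n ∷ [])))
    (trans (sum-++ (map f (upTo n)) (f n ∷ [])) (cong (sum (map f (upTo n)) +_) (+-identityʳ (f n)))))

  -- Deficits of Lyndon words

  deficit : ℕ → List (Word q) → ℕ
  deficit n xs = sum (map (λ x → n ∸ length x) xs)

  deficit-++ : ∀ n (xs ys : List (Word q)) → deficit n (xs ++ ys) ≡ deficit n xs + deficit n ys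
  deficit-++ n xs ys = trans (cong sum (map-++ (λ x → n ∸ length x) xs ys)) (sum-++ (map (λ x → n ∸ length x) xs) _)

  deficit-suc : ∀ n {xs : List (Word q)} → All (λ x → length x ≤ n) xs → deficit (suc n) xs ≡ length xs + deficit n xs
  deficit-suc n []                    = refl
  deficit-suc n {x ∷ xs} (x≤n ∷ xs≤n) = begin
    (suc n ∸ length x) + deficit (suc n) xs           ≡⟨ cong₂ _+_ (+-∸-assoc 1 x≤n) (deficit-suc n xs≤n) ⟩
    suc ((n ∸ length x) + (length xs + deficit n xs)) ≡⟨ cong suc (+-assoc (n ∸ length x) _ _) ⟨
    suc ((n ∸ length x) + length xs + deficit n xs)   ≡⟨ cong (λ m → suc (m + deficit n xs)) (+-comm (n ∸ length x) _) ⟩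
    suc (length xs + (n ∸ length x) + deficit n xs)   ≡⟨ cong suc (+-assoc (length xs) _ _) ⟩
    suc (length xs + ((n ∸ length x) + deficit n xs)) ∎
    where open ≡.≡-Reasoning

  deficit-zero : ∀ n {xs : List (Word q)} → All (λ x → length x ≡ n) xs → deficit n xs ≡ 0
  deficit-zero n []          = refl
  deficit-zero n (refl ∷ eq) = cong₂ _+_ (n∸n≡0 n) (deficit-zero n eq)

  lyndonsUpTo-length≤ : ∀ n → All (λ x → length x ≤ n) (lyndonsUpTo q n)
  lyndonsUpTo-length≤ zero    = []
  lyndonsUpTo-length≤ (suc n) =
    All.++⁺ (All.map m≤n⇒m≤1+n (lyndonsUpTo-length≤ n)) (All.map (≤-reflexive ∘ proj₁) (lyndons-sound (suc n)))

  length-lyndonsUpTo : ∀ n → length (lyndonsUpTo q n) ≡ L q n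
  length-lyndonsUpTo zero        = refl
  length-lyndonsUpTo {q} (suc n) = trans (length-++ (lyndonsUpTo q n))
    (trans (cong (_+ ℓ q (suc n)) (length-lyndonsUpTo n)) (≡.sym (sum-upTo-suc (λ i → ℓ q (suc i)) n)))

  -- A Lyndon word of length i ≤ n is counted in L_i, ..., L_n, that is n + 1 - i times in Λ_n,
  -- which is its deficit. In the induction every earlier word gains one, and together these gains
  -- are the new summand L.
  deficit-lyndonsUpTo-suc : ∀ n → deficit (suc n) (lyndonsUpTo q (suc n)) ≡ Λ q n
  deficit-lyndonsUpTo-suc {q} n = begin
    deficit (suc n) (lyndonsUpTo q n ++ lyndons q (suc n))
      ≡⟨ deficit-++ (suc n) (lyndonsUpTo q n) _ ⟩
    deficit (suc n) (lyndonsUpTo q n) + deficit (suc n) (lyndons q (suc n))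
      ≡⟨ cong₂ _+_ (deficit-suc n (lyndonsUpTo-length≤ n)) (deficit-zero (suc n) (All.map proj₁ (lyndons-sound {q} (suc n)))) ⟩
    length (lyndonsUpTo q n) + deficit n (lyndonsUpTo q n) + 0
      ≡⟨ +-identityʳ _ ⟩
    length (lyndonsUpTo q n) + deficit n (lyndonsUpTo q n)
      ≡⟨ total n ⟩
    Λ q n ∎
    where
    open ≡.≡-Reasoning
    total : ∀ n → length (lyndonsUpTo q n) + deficit n (lyndonsUpTo q n) ≡ Λ q n
    total zero    = refl
    total (suc n) = begin
      length (lyndonsUpTo q (suc n)) + deficit (suc n) (lyndonsUpTo q (suc n))
        ≡⟨ cong₂ _+_ (length-lyndonsUpTo (suc n)) (deficit-lyndonsUpTo-suc n) ⟩
      L q (suc n) + Λ q n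
        ≡⟨ +-comm (L q (suc n)) _ ⟩
      Λ q n + L q (suc n)
        ≡⟨ sum-upTo-suc (λ i → L q (suc i)) n ⟨
      Λ q (suc n) ∎

  Λ-suc∸L : ∀ q n → Λ q (suc n) ∸ L q (suc n) ≡ Λ q n
  Λ-suc∸L q n = trans (cong (_∸ L q (suc n)) (sum-upTo-suc (λ i → L q (suc i)) n)) (m+n∸n≡m (Λ q n) (L q (suc n)))

  -- Transitions between consecutive Lyndon words

  consecutive-tops : ∀ {n} (p : Word q) {s t a b} → a Fin.< b →
    length (p ++ a ∷ s) ≡ n → Lyndon (p ++ a ∷ s) →
    (∀ z → length z ≡ n → Lyndon z → (p ++ a ∷ s) <lex z → ¬ z <lex (p ++ b ∷ t)) → All Top s
  consecutive-tops p {s} {a = a} a<b len lyn gap with tops-or-less s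
  ... | inj₁ tops = tops
  -- Raising `c` keeps the prefix `p ++ a ∷ g`, so the new Lyndon word lies above the old one and,
  -- because a < b, still below `p ++ b ∷ t`.
  ... | inj₂ (g , c , z , refl , c+1<q) = ⊥-elim (gap _ len′ lyn′
      (++-monoʳ-<lex p (next refl (++-monoʳ-<lex g (this c<c′)))) (++-monoʳ-<lex p (this a<b)))
    where
    length-split : ∀ {c z} → length (p ++ a ∷ g ++ c ∷ z) ≡ length p + suc (length g + suc (length z))
    length-split {c} {z} = trans (length-++ p) (cong (λ m → length p + suc m) (length-++ g))
    increase = Lyndon-increase (p ++ a ∷ g)
      (subst (1 ≤_) (≡.sym (length-++ p)) (≤-trans (s≤s z≤n) (m≤n+m _ (length p))))
      (subst Lyndon (≡.sym (++-assoc p (a ∷ g) _)) lyn) c+1<q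
    c<c′ = proj₁ (proj₂ (proj₂ increase))
    len′ = trans length-split (trans (cong (λ m → length p + suc (length g + suc m)) (proj₁ (proj₂ (proj₂ (proj₂ increase)))))
      (trans (≡.sym length-split) len))
    lyn′ = subst Lyndon (++-assoc p (a ∷ g) _) (proj₂ (proj₂ (proj₂ (proj₂ increase))))

  -- The relation mid ≤ w′ is expressed through the words above `w′`. This covers both `mid` equal
  -- to `w′` and `mid` a proper prefix of it, and gives at once that the words `mid` of later
  -- transitions are larger.
  record Transition {q} (n : ℕ) (w w′ : Word q) : Set where
    field
      mid      : Word q
      midLyn   : Lyndon mid
      1≤mid    : 1 ≤ length mid
      mid≤n    : length mid ≤ n
      w<mid    : w <lex mid
      mid≤w′   : ∀ {y} → w′ <lex y → mid <lex y
      updates  : List (Update q)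
      correct  : applyUpdates updates (compress w) ≡ just (compress w′)
      cost     : length updates + endsInTop w ≤ 3 * (n ∸ length mid) + 1 + endsInTop w′

  transition : ∀ {n} → length w ≡ n → length w′ ≡ n → Lyndon w → w <lex w′ →
    (∀ z → length z ≡ n → Lyndon z → w <lex z → ¬ z <lex w′) → Transition n w w′
  transition {n = n} len len′ lyn w<w′ gap with <lex⇒Diverge (trans len (≡.sym len′)) w<w′
  ... | diverge {a} {b} p s t a<b = record
    { mid     = p ++ b ∷ []
    ; midLyn  = Lyndon-raise p lyn a<b []
    ; 1≤mid   = subst (1 ≤_) (≡.sym length-mid) (s≤s z≤n)
    ; mid≤n   = subst₂ _≤_ (≡.sym length-mid) n≡ (m≤m+n _ _)
    ; w<mid   = ++-monoʳ-<lex p (this a<b)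
    ; mid≤w′  = λ {y} lt → ++-<lex (p ++ b ∷ []) (subst (_<lex y) (≡.sym (++-assoc p (b ∷ []) t)) lt)
    ; updates = proj₁ edit
    ; correct = proj₂ (proj₂ edit)
    ; cost    = subst₂ (λ k m → k + endsInTop (p ++ a ∷ s) ≤ 3 * m + 1 + endsInTop (p ++ b ∷ t))
                  (≡.sym (proj₁ (proj₂ edit))) (≡.sym deficit-mid) (proj₂ (proj₂ ec))
    }
    where
    length-∷ : ∀ c (r : Word _) → length (p ++ c ∷ r) ≡ suc (length p) + length r
    length-∷ c r = trans (length-++ p) (+-suc (length p) (length r))
    length-mid : length (p ++ b ∷ []) ≡ suc (length p)
    length-mid = trans (length-∷ b []) (+-identityʳ _)
    n≡ : suc (length p) + length t ≡ n
    n≡ = trans (≡.sym (length-∷ b t)) len′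
    deficit-mid : n ∸ length (p ++ b ∷ []) ≡ length t
    deficit-mid = trans (cong₂ _∸_ (≡.sym n≡) length-mid) (m+n∸m≡n (suc (length p)) (length t))
    length-s : length s ≡ length t
    length-s = +-cancelˡ-≡ (suc (length p)) _ _
      (trans (≡.sym (length-∷ a s)) (trans len (trans (≡.sym len′) (length-∷ b t))))
    ec = edit-cost p a<b (consecutive-tops p a<b len lyn gap) length-s
    edit = proj₁ (proj₂ ec)

  record Run {q} (n : ℕ) (w : Word q) (ws : List (Word q)) : Set where
    field
      updates  : List (List (Update q))
      mids     : List (Word q)
      steps    : Steps (w ∷ ws) updates
      midsLyn  : All (λ x → Lyndon x × 1 ≤ length x × length x ≤ n) mids
      w<mids   : All (w <lex_) mids
      sorted   : AllPairs _<lex_ mids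
      cost     : totalUpdates updates + endsInTop w ≤ 3 * deficit n mids + length (w ∷ ws)

  run : ∀ n w (ws : List (Word q)) → All (λ w → length w ≡ n × Lyndon w) (w ∷ ws) →
        AllPairs _<lex_ (w ∷ ws) →
        (∀ z → length z ≡ n → Lyndon z → w <lex z → z ∈ ws) → Run n w ws
  run n w [] _ _ _ = record
    { updates = [] ; mids = [] ; steps = single w ; midsLyn = [] ; w<mids = [] ; sorted = []
    -- No transition leaves the last word, so its unit in the count of words is free to pay the
    -- final potential.
    ; cost = endsInTop≤1 w }
  run n w (w′ ∷ ws) ((len , lyn) ∷ lyns@((len′ , lyn′) ∷ _)) ((w<w′ ∷ w<ws) ∷ sorted@(w′<ws ∷ _)) complete = record
    { updates = T.updates ∷ R.updates
    ; mids    = T.mid ∷ R.mids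
    ; steps   = step T.correct R.steps
    ; midsLyn = (T.midLyn , T.1≤mid , T.mid≤n) ∷ R.midsLyn
    ; w<mids  = T.w<mid ∷ All.map (<lex-trans w<w′) R.w<mids
    ; sorted  = All.map T.mid≤w′ R.w<mids ∷ R.sorted
    ; cost    = amortize (length T.updates) (totalUpdates R.updates) (endsInTop w) (endsInTop w′)
                  (n ∸ length T.mid) (deficit n R.mids) (length (w′ ∷ ws)) T.cost R.cost
    }
    where
    gap : ∀ z → length z ≡ n → Lyndon z → w <lex z → ¬ z <lex w′
    gap z lenz lynz w<z z<w′ with complete z lenz lynz w<z
    ... | here refl  = <lex-irrefl z<w′
    ... | there z∈ws = <lex-asym z<w′ (All.lookup w′<ws z∈ws)
    complete′ : ∀ z → length z ≡ n → Lyndon z → w′ <lex z → z ∈ ws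
    complete′ z lenz lynz w′<z with complete z lenz lynz (<lex-trans w<w′ w′<z)
    ... | here refl  = contradiction w′<z <lex-irrefl
    ... | there z∈ws = z∈ws
    module T = Transition (transition len len′ lyn w<w′ gap)
    module R = Run (run n w′ ws lyns sorted complete′)
    -- The potential `e′` of the intermediate word stands on opposite sides of the two estimates and
    -- cancels when they are added.
    amortize : ∀ u us e e′ d ds l → u + e ≤ 3 * d + 1 + e′ → us + e′ ≤ 3 * ds + l →
               u + us + e ≤ 3 * (d + ds) + suc l
    amortize u us e e′ d ds l h h′ = +-cancelʳ-≤ e′ _ _ (begin
      u + us + e + e′                     ≡⟨ solve 4 (λ u us e e′ → u :+ us :+ e :+ e′ := (u :+ e) :+ (us :+ e′)) refl u us e e′ ⟩
      (u + e) + (us + e′)                 ≤⟨ +-mono-≤ h h′ ⟩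
      (3 * d + 1 + e′) + (3 * ds + l)     ≡⟨ solve 4 (λ d ds e′ l → (con 3 :* d :+ con 1 :+ e′) :+ (con 3 :* ds :+ l)
                                                   := con 3 :* (d :+ ds) :+ (con 1 :+ l) :+ e′) refl d ds e′ l ⟩
      3 * (d + ds) + suc l + e′           ∎)
      where open ≤-Reasoning
            open +-*-Solver

  -- The list is passed as a variable with an equation so that it can be matched against `[]`, which
  -- does occur, for instance for q = 1 and length 2.
  enumeration : (q n : ℕ) → ∀ ws → lyndons q (suc n) ≡ ws →
                ∃ λ us → Steps ws us × totalUpdates us ≤ 3 * (Λ q (suc n) ∸ L q (suc n)) + length ws
  enumeration q n []       eq = [] , none , z≤n
  enumeration q n (w ∷ ws) eq = R.updates , R.steps , (begin
      totalUpdates R.updates                             ≤⟨ m≤m+n _ (endsInTop w) ⟩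
      totalUpdates R.updates + endsInTop w               ≤⟨ R.cost ⟩
      3 * deficit (suc n) R.mids + length (w ∷ ws)       ≤⟨ +-monoˡ-≤ _ (*-monoʳ-≤ 3 deficit≤) ⟩
      3 * (Λ q (suc n) ∸ L q (suc n)) + length (w ∷ ws)  ∎)
    where
    open ≤-Reasoning
    complete : ∀ z → length z ≡ suc n → Lyndon z → w <lex z → z ∈ ws
    complete z lenz lynz w<z with subst (z ∈_) eq (subst (λ m → z ∈ lyndons q m) lenz (∈-lyndons lynz))
    ... | here refl  = contradiction w<z <lex-irrefl
    ... | there z∈ws = z∈ws
    sound : All (λ w → length w ≡ suc n × Lyndon w) (w ∷ ws)
    sound = subst (All _) eq (lyndons-sound (suc n))
    sorted : AllPairs _<lex_ (w ∷ ws)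
    sorted = subst (AllPairs _<lex_) eq (lyndons-sorted (suc n))
    module R = Run (run (suc n) w ws sound sorted complete)
    deficit≤ : deficit (suc n) R.mids ≤ Λ q (suc n) ∸ L q (suc n)
    deficit≤ = begin
      deficit (suc n) R.mids                     ≤⟨ sum-⊆ _ (AllPairs.map (λ { x<x refl → <lex-irrefl x<x }) R.sorted)
                                                     (λ x∈ → let lyn , 1≤x , x≤n = All.lookup R.midsLyn x∈ in ∈-lyndonsUpTo lyn 1≤x x≤n) ⟩
      deficit (suc n) (lyndonsUpTo q (suc n))    ≡⟨ deficit-lyndonsUpTo-suc n ⟩
      Λ q n                                      ≡⟨ Λ-suc∸L q n ⟨
      Λ q (suc n) ∸ L q (suc n)                  ∎

  enumerate : (q n : ℕ) → 1 ≤ n →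
    Σ (List (Word q)) λ ws → Σ (List (List (Update q))) λ us →
      All (λ w → length w ≡ n × Lyndon w) ws
      × ((w : Word q) → length w ≡ n → Lyndon w → w ∈ ws)
      × Linked _<lex_ ws
      × Steps ws us
      × totalUpdates us ≤ bound q n
  enumerate q n@(suc m) _ = let us , steps , cost = enumeration q m (lyndons q n) refl in
    lyndons q n , us , lyndons-sound n , (λ w len lyn → subst (λ k → w ∈ lyndons q k) len (∈-lyndons lyn)) ,
    Linked.AllPairs⇒Linked (lyndons-sorted n) , steps , cost

-- Counting Lyndon words through rotations

module Counting where

  open Enumeration
  open import Data.Nat using (_+_; _<_)

  private variable
    q : ℕ
    u v w : Word q

  rotate : Word q → Word q
  rotate []      = []
  rotate (a ∷ w) = w ++ a ∷ []

  -- Iterated single steps are additive in the exponent without any bound on it, whereas `rot k` is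
  -- the identity for every k beyond the length.
  rotates : ℕ → Word q → Word q
  rotates zero    w = w
  rotates (suc k) w = rotates k (rotate w)

  rotates-length-++ : ∀ (u v : Word q) → rotates (length u) (u ++ v) ≡ v ++ u
  rotates-length-++ []      v = ≡.sym (++-identityʳ v)
  rotates-length-++ (a ∷ u) v = trans (cong (rotates (length u)) (++-assoc u v (a ∷ [])))
    (trans (rotates-length-++ u (v ++ a ∷ [])) (++-assoc v (a ∷ []) u))

  rot≡rotates : ∀ {k} (w : Word q) → k ≤ length w → rot k w ≡ rotates k w
  rot≡rotates {k = k} w k≤w = ≡.sym (trans
    (cong₂ rotates (≡.sym (trans (length-take k w) (m≤n⇒m⊓n≡m k≤w))) (≡.sym (take++drop≡id k w)))
    (rotates-length-++ (take k w) (drop k w)))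

  rotates-+ : ∀ j k (w : Word q) → rotates (j + k) w ≡ rotates k (rotates j w)
  rotates-+ zero    k w = refl
  rotates-+ (suc j) k w = rotates-+ j k (rotate w)

  rotates-comm : ∀ j k (w : Word q) → rotates j (rotates k w) ≡ rotates k (rotates j w)
  rotates-comm j k w = trans (≡.sym (rotates-+ k j w)) (trans (cong (λ i → rotates i w) (+-comm k j)) (rotates-+ j k w))

  rotates-length : ∀ (w : Word q) → rotates (length w) w ≡ w
  rotates-length w = trans (cong (rotates (length w)) (≡.sym (++-identityʳ w))) (rotates-length-++ w [])

  length-rotate : ∀ (w : Word q) → length (rotate w) ≡ length w
  length-rotate []      = refl
  length-rotate (a ∷ w) = trans (length-++ w) (+-comm (length w) 1)

  length-rotates : ∀ k (w : Word q) → length (rotates k w) ≡ length w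
  length-rotates zero    w = refl
  length-rotates (suc k) w = trans (length-rotates k (rotate w)) (length-rotate w)

  rotates-inverse : ∀ {k} (w : Word q) → k ≤ length w → rotates (length w ∸ k) (rotates k w) ≡ w
  rotates-inverse {k = k} w k≤w = trans (≡.sym (rotates-+ k (length w ∸ k) w))
    (trans (cong (λ i → rotates i w) (m+[n∸m]≡n k≤w)) (rotates-length w))

  rotates-injective : ∀ {k} → k ≤ length u → length u ≡ length v → rotates k u ≡ rotates k v → u ≡ v
  rotates-injective {u = u} {v} {k} k≤u len eq = trans (≡.sym (rotates-inverse u k≤u))
    (trans (cong₂ (λ m x → rotates (m ∸ k) x) len eq) (rotates-inverse v (subst (k ≤_) len k≤u)))

  Lyndon⇒<rotates : ∀ {k} → Lyndon w → 1 ≤ k → k < length w → w <lex rotates k w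
  Lyndon⇒<rotates {w = w} {k} lyn 1≤k k<w = subst (w <lex_) (trans (cong (λ i → rot i w) k≡) (rot≡rotates w (<⇒≤ k<w)))
    (lyn (Fin.fromℕ< k<w) (subst (1 ≤_) (≡.sym k≡) 1≤k))
    where
    k≡ = Fin.toℕ-fromℕ< k<w

  -- For positive `d`, `w` is below its rotation `u`. Rotating `u` by the complementary amount
  -- returns `w`, so `u` would be below `w` as well.
  rotation-unique : ∀ {d} → Lyndon u → Lyndon w → d < length w → u ≡ rotates d w → d ≡ 0
  rotation-unique {d = zero}  _    _    _   _    = refl
  rotation-unique {w = w} {d = suc d} lynu lynw d<w refl = contradiction
    (subst (rotates (suc d) w <lex_) (rotates-inverse w (<⇒≤ d<w))
      (Lyndon⇒<rotates lynu (m<n⇒0<n∸m d<w) (subst (length w ∸ suc d <_) (≡.sym (length-rotates (suc d) w)) (∸-monoʳ-< (s≤s z≤n) (<⇒≤ d<w)))))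
    (<lex-asym (Lyndon⇒<rotates lynw (s≤s z≤n) d<w))

  rotations-injective-≤ : ∀ {m j k} → Lyndon u → Lyndon w → length u ≡ m → length w ≡ m → k < m → j ≤ k →
                          rotates (suc j) u ≡ rotates (suc k) w → j ≡ k × u ≡ w
  rotations-injective-≤ {u = u} {w} {j = j} {k} lynu lynw refl lenw k<m j≤k eq =
    ≤-antisym j≤k (m∸n≡0⇒m≤n d≡0) , trans u≡ (cong (λ d → rotates d w) d≡0)
    where
    u≡ : u ≡ rotates (k ∸ j) w
    u≡ = rotates-injective (≤-trans (s≤s j≤k) k<m) (trans (≡.sym lenw) (≡.sym (length-rotates (k ∸ j) w)))
      (trans eq (trans (cong (λ i → rotates i w) (≡.sym (trans (+-suc (k ∸ j) j) (cong suc (m∸n+n≡m j≤k)))))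
        (rotates-+ (k ∸ j) (suc j) w)))
    d≡0 : k ∸ j ≡ 0
    d≡0 = rotation-unique lynu lynw (subst (k ∸ j <_) (≡.sym lenw) (≤-<-trans (m∸n≤m k j) k<m)) u≡

  rotations-injective : ∀ {m j k} → Lyndon u → Lyndon w → length u ≡ m → length w ≡ m → j < m → k < m →
                        rotates (suc j) u ≡ rotates (suc k) w → j ≡ k × u ≡ w
  rotations-injective {j = j} {k} lynu lynw lenu lenw j<m k<m eq with ≤-total j k
  ... | inj₁ j≤k = rotations-injective-≤ lynu lynw lenu lenw k<m j≤k eq
  ... | inj₂ k≤j =
    let k≡j , w≡u = rotations-injective-≤ lynw lynu lenw lenu j<m k≤j (≡.sym eq) in ≡.sym k≡j , ≡.sym w≡u

  map-unique : ∀ {A B : Set} {f : A → B} {xs} → (∀ {x y} → x ∈ xs → y ∈ xs → f x ≡ f y → x ≡ y) →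
               Unique xs → Unique (map f xs)
  map-unique inj []           = []
  map-unique inj (x∉xs ∷ xs!) =
    All.map⁺ (All.tabulate λ y∈xs eq → All.lookup x∉xs y∈xs (inj (here refl) (there y∈xs) eq)) ∷
    map-unique (λ x∈ y∈ → inj (there x∈) (there y∈)) xs!

  length-⊆ : ∀ {A : Set} {xs ys : List A} → Unique xs → (∀ {x} → x ∈ xs → x ∈ ys) → length xs ≤ length ys
  length-⊆ {xs = xs} {ys} xs! sub = subst₂ _≤_ (sum-ones xs) (sum-ones ys) (sum-⊆ (const 1) xs! sub)
    where
    sum-ones : ∀ {A : Set} (xs : List A) → sum (map (const 1) xs) ≡ length xs
    sum-ones []       = refl
    sum-ones (_ ∷ xs) = cong suc (sum-ones xs)

  length-cartesianProductWith : ∀ {A B C : Set} (f : A → B → C) xs ys →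
    length (cartesianProductWith f xs ys) ≡ length xs * length ys
  length-cartesianProductWith f []       ys = refl
  length-cartesianProductWith f (x ∷ xs) ys = trans (length-++ (map (f x) ys))
    (cong₂ _+_ (length-map (f x) ys) (length-cartesianProductWith f xs ys))

  length-allWords : ∀ q m → length (allWords q m) ≡ q ^ m
  length-allWords q zero    = refl
  length-allWords q (suc m) = trans (extend (allFin q)) (cong₂ _*_ (length-tabulate {n = q} (λ i → i)) (length-allWords q m))
    where
    extend : ∀ (as : List (Fin q)) → length (concatMap (λ a → map (a ∷_) (allWords q m)) as) ≡ length as * length (allWords q m)
    extend []       = refl
    extend (a ∷ as) = trans (length-++ (map (a ∷_) (allWords q m))) (cong₂ _+_ (length-map (a ∷_) (allWords q m)) (extend as))

  -- Shifts run from 1 to m, with m as the identity, so the inverse m - k of any rotation by 0 ≤ k <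
  -- m is in the range.
  lyndonRotations : (q m : ℕ) → List (Word q)
  lyndonRotations q m = map (λ (j , w) → rotates (suc j) w) (cartesianProduct (upTo m) (lyndons q m))

  length-lyndonRotations : ∀ q m → length (lyndonRotations q m) ≡ m * ℓ q m
  length-lyndonRotations q m = trans (length-map _ (cartesianProduct (upTo m) (lyndons q m)))
    (trans (length-cartesianProductWith _,_ (upTo m) (lyndons q m)) (cong (_* ℓ q m) (length-upTo m)))

  ∈-lyndons⁻ : ∀ m → w ∈ lyndons q m → length w ≡ m × Lyndon w
  ∈-lyndons⁻ m w∈ = All.lookup (lyndons-sound m) w∈

  lyndonRotations-unique : ∀ q m → Unique (lyndonRotations q m)
  lyndonRotations-unique q m = map-unique inj
    (cartesianProduct⁺ (upTo⁺ m) (AllPairs.map (λ { x<x refl → <lex-irrefl x<x }) (lyndons-sorted m)))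
    where
    inj : ∀ {x y} → x ∈ cartesianProduct (upTo m) (lyndons q m) → y ∈ cartesianProduct (upTo m) (lyndons q m) →
          rotates (suc (proj₁ x)) (proj₂ x) ≡ rotates (suc (proj₁ y)) (proj₂ y) → x ≡ y
    inj {j , u} {k , w} x∈ y∈ eq =
      let j∈ , u∈ = ∈-cartesianProduct⁻ (upTo m) (lyndons q m) x∈
          k∈ , w∈ = ∈-cartesianProduct⁻ (upTo m) (lyndons q m) y∈
          lenu , lynu = ∈-lyndons⁻ m u∈
          lenw , lynw = ∈-lyndons⁻ m w∈
          j≡k , u≡w = rotations-injective lynu lynw lenu lenw (∈-upTo⁻ j∈) (∈-upTo⁻ k∈) eq
      in cong₂ _,_ j≡k u≡w

  m*ℓ≤q^m : ∀ q m → m * ℓ q m ≤ q ^ m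
  m*ℓ≤q^m q m = subst₂ _≤_ (length-lyndonRotations q m) (length-allWords q m)
    (length-⊆ {xs = lyndonRotations q m} {allWords q m} (lyndonRotations-unique q m) sub)
    where
    sub : ∀ {x} → x ∈ lyndonRotations q m → x ∈ allWords q m
    sub x∈ with ∈-map⁻ _ x∈
    ... | (j , w) , p∈ , refl = subst (λ k → rotates (suc j) w ∈ allWords q k)
      (trans (length-rotates (suc j) w) (proj₁ (∈-lyndons⁻ m (proj₂ (∈-cartesianProduct⁻ (upTo m) (lyndons q m) p∈)))))
      (∈-allWords (rotates (suc j) w))

  minimum : ∀ (f : ℕ → Word q) m → ∃ λ k → k ≤ m × (∀ j → j ≤ m → ¬ f j <lex f k)
  minimum f zero    = 0 , z≤n , λ { zero z≤n → <lex-irrefl }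
  minimum f (suc m) with minimum f m
  ... | k , k≤m , min with f (suc m) <lex? f k
  ...   | yes lt = suc m , ≤-refl , min′
    where
    min′ : ∀ j → j ≤ suc m → ¬ f j <lex f (suc m)
    min′ j j≤ lt′ with m≤n⇒m<n∨m≡n j≤
    ... | inj₁ j<  = min j (≤-pred j<) (<lex-trans lt′ lt)
    ... | inj₂ refl = <lex-irrefl lt′
  ...   | no nlt = k , m≤n⇒m≤1+n k≤m , min′
    where
    min′ : ∀ j → j ≤ suc m → ¬ f j <lex f k
    min′ j j≤ with m≤n⇒m<n∨m≡n j≤
    ... | inj₁ j<  = min j (≤-pred j<)
    ... | inj₂ refl = nlt

  -- Words fixed by a rotation

  take-++-≤ : ∀ {A : Set} {n} (xs ys : List A) → n ≤ length xs → take n (xs ++ ys) ≡ take n xs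
  take-++-≤ {n = zero}  xs       ys _         = refl
  take-++-≤ {n = suc n} (x ∷ xs) ys (s≤s n≤) = cong (x ∷_) (take-++-≤ xs ys n≤)

  periodic : ℕ → Word q → Word q
  periodic m u = take m (concat (replicate m u))

  length-concat-replicate : ∀ n (u : Word q) → length (concat (replicate n u)) ≡ n * length u
  length-concat-replicate zero    u = refl
  length-concat-replicate (suc n) u = trans (length-++ u) (cong (length u +_) (length-concat-replicate n u))

  -- Commutation moves `uz` to the front past any number of copies of `u`. So `uz` and a power of
  -- `u` that is at least as long are prefixes of one word, and they agree on the length of `uz`.
  commute⇒periodic : ∀ (u z : Word q) → 1 ≤ length u → u ++ z ≡ z ++ u → u ++ z ≡ periodic (length (u ++ z)) u
  commute⇒periodic u z 1≤u uz≡zu = ≡.sym (begin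
    take m (concat (replicate m u))       ≡⟨ take-++-≤ _ uz m≤ ⟨
    take m (concat (replicate m u) ++ uz)  ≡⟨ cong (take m) (proj₂ (absorb m)) ⟩
    take m (uz ++ proj₁ (absorb m))        ≡⟨ take-length-++ uz _ ⟩
    uz                                     ∎)
    where
    open ≡.≡-Reasoning
    uz = u ++ z
    m = length uz
    m≤ : m ≤ length (concat (replicate m u))
    m≤ = subst₂ _≤_ (*-identityʳ m) (≡.sym (length-concat-replicate m u)) (*-monoʳ-≤ m 1≤u)
    absorb : ∀ k → ∃ λ r → concat (replicate k u) ++ uz ≡ uz ++ r
    absorb zero    = [] , ≡.sym (++-identityʳ uz)
    absorb (suc k) with absorb k
    ... | r , eq = u ++ r , (begin
      (u ++ concat (replicate k u)) ++ uz  ≡⟨ ++-assoc u _ uz ⟩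
      u ++ concat (replicate k u) ++ uz    ≡⟨ cong (u ++_) eq ⟩
      u ++ uz ++ r                         ≡⟨ cong (λ x → u ++ x ++ r) uz≡zu ⟩
      u ++ (z ++ u) ++ r                  ≡⟨ cong (u ++_) (++-assoc z u r) ⟩
      u ++ z ++ u ++ r                    ≡⟨ ++-assoc u z (u ++ r) ⟨
      uz ++ u ++ r                         ∎)

  -- A period block of length at most ⌊m/2⌋ is coded as a prefix of a word of length exactly ⌊m/2⌋,
  -- which turns the list into a product of known size. Repetitions do no harm in an upper bound.
  periodicWords : (q m : ℕ) → List (Word q)
  periodicWords q m = cartesianProductWith (λ j u → periodic m (take (suc j) u)) (upTo m) (allWords q ⌊ m /2⌋)

  length-periodicWords : ∀ q m → length (periodicWords q m) ≡ m * q ^ ⌊ m /2⌋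
  length-periodicWords q m = trans (length-cartesianProductWith _ (upTo m) (allWords q ⌊ m /2⌋))
    (cong₂ _*_ (length-upTo m) (length-allWords q ⌊ m /2⌋))

  fixed-short : ∀ {j} (w : Word q) → suc j ≤ ⌊ length w /2⌋ → rotates (suc j) w ≡ w → w ∈ periodicWords q (length w)
  fixed-short {q} {j} w j≤ fix = subst (_∈ periodicWords q m) (≡.sym w≡)
    (∈-cartesianProductWith⁺ (λ j u → periodic m (take (suc j) u)) (∈-upTo⁺ j<m)
      (subst (λ k → take h w ∈ allWords q k) (trans (length-take h w) (m≤n⇒m⊓n≡m (⌊n/2⌋≤n m))) (∈-allWords (take h w))))
    where
    open ≡.≡-Reasoning
    m = length w
    h = ⌊ m /2⌋
    j<m : suc j ≤ m
    j<m = ≤-trans j≤ (⌊n/2⌋≤n m)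
    pre = take (suc j) w
    suf = drop (suc j) w
    w≡ : w ≡ periodic m (take (suc j) (take h w))
    w≡ = begin
      w                          ≡⟨ take++drop≡id (suc j) w ⟨
      pre ++ suf                     ≡⟨ commute⇒periodic pre suf
                                      (subst (1 ≤_) (≡.sym (trans (length-take (suc j) w) (m≤n⇒m⊓n≡m j<m))) (s≤s z≤n))
                                      (trans (take++drop≡id (suc j) w) (≡.sym (trans (rot≡rotates w j<m) fix))) ⟩
      periodic (length (pre ++ suf)) pre  ≡⟨ cong (λ x → periodic (length x) pre) (take++drop≡id (suc j) w) ⟩
      periodic m pre             ≡⟨ cong (λ k → periodic m (take k w)) (m≤n⇒m⊓n≡m j≤) ⟨
      periodic m (take (suc j ⊓ h) w)   ≡⟨ cong (periodic m) (take-take (suc j) h w) ⟨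
      periodic m (take (suc j) (take h w)) ∎

  -- A word of length m fixed by the rotation by `j` is also fixed by the one by m - j, and one of
  -- the two amounts is at most ⌊m/2⌋.
  fixed⇒periodic : ∀ {j} (w : Word q) → 1 ≤ j → j < length w → rotates j w ≡ w → w ∈ periodicWords q (length w)
  fixed⇒periodic {j = suc j} w 1≤j j<m fix with suc j ≤? ⌊ length w /2⌋
  ... | yes j≤ = fixed-short w j≤ fix
  ... | no  j≰ with length w ∸ suc j in eq
  ...   | zero  = contradiction eq (m<n⇒n≢0 (m<n⇒0<n∸m j<m))
  ...   | suc i = fixed-short w i≤ (trans (cong₂ rotates (≡.sym eq) (≡.sym fix)) (rotates-inverse w (<⇒≤ j<m)))
    where
    i≤ : suc i ≤ ⌊ length w /2⌋
    i≤ = subst (_≤ ⌊ length w /2⌋) eq (m≤n+o⇒m∸n≤o (length w) (suc j) (begin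
      length w                                    ≡⟨ ⌊n/2⌋+⌈n/2⌉≡n (length w) ⟨
      ⌊ length w /2⌋ + ⌊ suc (length w) /2⌋       ≤⟨ +-monoʳ-≤ ⌊ length w /2⌋ (⌊n/2⌋-mono (n≤1+n (suc (length w)))) ⟩
      ⌊ length w /2⌋ + suc ⌊ length w /2⌋         ≤⟨ +-monoʳ-≤ ⌊ length w /2⌋ (≰⇒> j≰) ⟩
      ⌊ length w /2⌋ + suc j                      ≡⟨ +-comm ⌊ length w /2⌋ (suc j) ⟩
      suc j + ⌊ length w /2⌋                      ∎))
      where open ≤-Reasoning

  -- Take a least rotation r of `w`. If r is not Lyndon, some proper rotation of r is not above r;
  -- by minimality it is not below r either, so it equals r. Rotations commute, so the same amount
  -- fixes `w`.
  covered : ∀ m (w : Word q) → length w ≡ suc m → w ∈ lyndonRotations q (suc m) ++ periodicWords q (suc m)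
  covered {q} m w len with minimum (λ k → rotates k w) m
  ... | k , k≤m , min with lyndon? (rotates k w)
  ...   | yes lyn = ∈-++⁺ˡ (subst (_∈ lyndonRotations q (suc m)) w≡
      (∈-map⁺ (λ (j , w) → rotates (suc j) w) (∈-cartesianProduct⁺ (∈-upTo⁺ (s≤s (m∸n≤m m k))) v∈)))
    where
    v∈ : rotates k w ∈ lyndons q (suc m)
    v∈ = subst (λ i → rotates k w ∈ lyndons q i) (trans (length-rotates k w) len) (∈-lyndons lyn)
    w≡ : rotates (suc (m ∸ k)) (rotates k w) ≡ w
    w≡ = trans (cong (λ i → rotates i (rotates k w)) (trans (≡.sym (+-∸-assoc 1 k≤m)) (cong (_∸ k) (≡.sym len))))
      (rotates-inverse w (subst (k ≤_) (≡.sym len) (m≤n⇒m≤1+n k≤m)))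
  ...   | no ¬lyn = ∈-++⁺ʳ (lyndonRotations q (suc m))
      (subst (λ i → w ∈ periodicWords q i) len (fixed⇒periodic w 1≤i i<w fix))
    where
    r = rotates k w
    k≤w : k ≤ length w
    k≤w = subst (k ≤_) (≡.sym len) (m≤n⇒m≤1+n k≤m)
    witness = Fin.¬∀⟶∃¬ (length r) (λ i → 1 ≤ toℕ i → r <lex rot (toℕ i) r)
      (λ i → (1 ≤? toℕ i) →-dec (r <lex? rot (toℕ i) r)) ¬lyn
    i = toℕ (proj₁ witness)
    i<w : i < length w
    i<w = subst (i <_) (length-rotates k w) (Fin.toℕ<n (proj₁ witness))
    1≤i : 1 ≤ i
    1≤i with 1 ≤? i
    ... | yes p = p
    ... | no ¬p = contradiction (λ p → contradiction p ¬p) (proj₂ witness)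
    r≮ : ¬ r <lex rotates i r
    r≮ lt = proj₂ witness λ _ → subst (r <lex_)
      (≡.sym (rot≡rotates r (<⇒≤ (Fin.toℕ<n (proj₁ witness))))) lt
    ≮r : ¬ rotates i r <lex r
    ≮r with k + i ≤? m
    ... | yes k+i≤m = subst (λ x → ¬ x <lex r) (rotates-+ k i w) (min (k + i) k+i≤m)
    -- Minimality is known for the amounts 0, ..., m only, so k + i is reduced by the length m + 1.
    ... | no  k+i≰m = subst (λ x → ¬ x <lex r)
      (begin
        rotates (k + i ∸ suc m) w                           ≡⟨ cong (rotates (k + i ∸ suc m)) (rotates-length w) ⟨
        rotates (k + i ∸ suc m) (rotates (length w) w)      ≡⟨ rotates-+ (length w) (k + i ∸ suc m) w ⟨
        rotates (length w + (k + i ∸ suc m)) w              ≡⟨ cong (λ l → rotates (l + (k + i ∸ suc m)) w) len ⟩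
        rotates (suc m + (k + i ∸ suc m)) w                 ≡⟨ cong (λ l → rotates l w) (m+[n∸m]≡n (≰⇒> k+i≰m)) ⟩
        rotates (k + i) w                                   ≡⟨ rotates-+ k i w ⟩
        rotates i r                                         ∎)
      (min (k + i ∸ suc m) (m≤n+o⇒m∸n≤o (k + i) (suc m) (+-mono-≤ (m≤n⇒m≤1+n k≤m) (≤-pred (subst (i <_) len i<w)))))
      where open ≡.≡-Reasoning
    fix : rotates i w ≡ w
    fix = begin
      rotates i w                                ≡⟨ cong (rotates i) (rotates-inverse w k≤w) ⟨
      rotates i (rotates (length w ∸ k) r)       ≡⟨ rotates-comm i (length w ∸ k) r ⟩
      rotates (length w ∸ k) (rotates i r)       ≡⟨ cong (rotates (length w ∸ k)) (≮lex-antisym r≮ ≮r) ⟨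
      rotates (length w ∸ k) r                   ≡⟨ rotates-inverse w k≤w ⟩
      w                                          ∎
      where open ≡.≡-Reasoning

  q^m≤ : ∀ q m → q ^ suc m ≤ suc m * ℓ q (suc m) + suc m * q ^ ⌊ suc m /2⌋
  q^m≤ q m = subst₂ _≤_ (length-allWords q (suc m))
    (trans (length-++ (lyndonRotations q (suc m)))
      (cong₂ _+_ (length-lyndonRotations q (suc m)) (length-periodicWords q (suc m))))
    (length-⊆ {xs = allWords q (suc m)} (AllPairs.map (λ { x<x refl → <lex-irrefl x<x }) (allWords-sorted (suc m)))
      (λ {x} x∈ → covered m x (All.lookup (allWords-length (suc m)) x∈)))

-- Asymptotic equivalence over the natural numbers

module Limits where

  open Enumeration using (sum-upTo-suc; Λ-suc∸L)
  open Counting using (m*ℓ≤q^m; q^m≤)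
  open import Data.Nat using (_+_; _<_; ∣_-_∣)

  private variable
    f g h : ℕ → ℕ

  Eventually : (ℕ → Set) → Set
  Eventually P = ∃ λ N → ∀ n → N ≤ n → P n

  mapEventually : ∀ {P Q : ℕ → Set} → (∀ n → P n → Q n) → Eventually P → Eventually Q
  mapEventually pq (N , p) = N , λ n le → pq n (p n le)

  zipEventually : ∀ {P Q R : ℕ → Set} → (∀ n → P n → Q n → R n) → Eventually P → Eventually Q → Eventually R
  zipEventually pqr (N , p) (M , q) =
    N ⊔ M , λ n le → pqr n (p n (≤-trans (m≤m⊔n N M) le)) (q n (≤-trans (m≤n⊔m N M) le))

  unshiftEventually : ∀ {P : ℕ → Set} → Eventually (λ n → P (suc n)) → Eventually P
  unshiftEventually (N , p) = suc N , λ { (suc n) (s≤s le) → p n le }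

  Positive Unbounded : (ℕ → ℕ) → Set
  Positive  f = Eventually λ n → 1 ≤ f n
  Unbounded f = ∀ C → Eventually λ n → C ≤ f n

  infix 4 _~_

  -- f n / g n → 1
  record _~_ (f g : ℕ → ℕ) : Set where
    field eventually : ∀ K → Eventually λ n → K * ∣ f n - g n ∣ ≤ g n
  open _~_

  *-triangle-≤ : ∀ K {x y z c} → z ≤ x + y → 2 * K * x ≤ c → 2 * K * y ≤ c → K * z ≤ c
  *-triangle-≤ K {x} {y} {z} {c} z≤ x≤ y≤ = *-cancelˡ-≤ 2 (begin
    2 * (K * z)               ≡⟨ *-assoc 2 K z ⟨
    2 * K * z                 ≤⟨ *-monoʳ-≤ (2 * K) z≤ ⟩
    2 * K * (x + y)           ≡⟨ *-distribˡ-+ (2 * K) x y ⟩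
    2 * K * x + 2 * K * y     ≤⟨ +-mono-≤ x≤ y≤ ⟩
    c + c                     ≡⟨ cong (_+_ c) (+-identityʳ c) ⟨
    2 * c                     ∎)
    where open ≤-Reasoning

  ≗⇒~ : (∀ n → f n ≡ g n) → f ~ g
  ≗⇒~ {f} {g} f≗g .eventually K = 0 , λ n _ → subst (_≤ g n)
    (≡.sym (trans (cong (λ x → K * ∣ x - g n ∣) (f≗g n)) (trans (cong (K *_) (m≡n⇒∣m-n∣≡0 {g n} refl)) (*-zeroʳ K)))) z≤n

  -- With d = |f - g|, (K + 1) d ≤ g ≤ f + d gives K d ≤ f, so precision K + 1 suffices.
  ~-sym : f ~ g → g ~ f
  ~-sym {f} {g} f~g .eventually K = mapEventually close (f~g .eventually (suc K))
    where
    close : ∀ n → suc K * ∣ f n - g n ∣ ≤ g n → K * ∣ g n - f n ∣ ≤ f n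
    close n le = subst (λ d → K * d ≤ f n) (∣-∣-comm (f n) (g n))
      (+-cancelˡ-≤ ∣ f n - g n ∣ _ _ (≤-trans le (subst (g n ≤_) (+-comm (f n) _) (m≤n+∣n-m∣ (g n) (f n)))))

  ~-trans : f ~ g → g ~ h → f ~ h
  ~-trans {f} {g} {h} f~g g~h .eventually K =
    -- The first error is measured against g, and g ≤ 2 h, so it needs precision 4 K where 2 K would
    -- do against h. The `suc` ensures |g - h| ≤ h even for K = 0.
    zipEventually close (f~g .eventually (2 * (2 * K))) (g~h .eventually (suc (2 * K)))
    where
    open ≤-Reasoning
    close : ∀ n → 2 * (2 * K) * ∣ f n - g n ∣ ≤ g n → suc (2 * K) * ∣ g n - h n ∣ ≤ h n → K * ∣ f n - h n ∣ ≤ h n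
    close n fg gh = *-triangle-≤ K (∣-∣-triangle (f n) (g n) (h n))
      (*-cancelˡ-≤ 2 (begin
        2 * (2 * K * ∣ f n - g n ∣)  ≡⟨ *-assoc 2 (2 * K) _ ⟨
        2 * (2 * K) * ∣ f n - g n ∣  ≤⟨ fg ⟩
        g n                          ≤⟨ m≤n+∣m-n∣ (g n) (h n) ⟩
        h n + ∣ g n - h n ∣          ≤⟨ +-monoʳ-≤ (h n) (≤-trans (m≤m+n _ _) gh) ⟩
        h n + h n                    ≡⟨ cong (_+_ (h n)) (+-identityʳ (h n)) ⟨
        2 * h n                      ∎))
      (≤-trans (m≤n+m _ ∣ g n - h n ∣) gh)

  *-comm-assoc : ∀ a b c → a * (b * c) ≡ b * (a * c)
  *-comm-assoc a b c = trans (≡.sym (*-assoc a b c)) (trans (cong (_* c) (*-comm a b)) (*-assoc b a c))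

  ~-*ˡ : ∀ (k : ℕ → ℕ) → f ~ g → (λ n → k n * f n) ~ (λ n → k n * g n)
  ~-*ˡ {f} {g} k f~g .eventually K = mapEventually
    (λ n le → subst (_≤ k n * g n)
      (trans (*-comm-assoc (k n) K _) (cong (K *_) (*-distribˡ-∣-∣ (k n) (f n) (g n))))
      (*-monoʳ-≤ (k n) le))
    (f~g .eventually K)

  ~-cancelˡ : ∀ (k : ℕ → ℕ) → (λ n → suc (k n) * f n) ~ (λ n → suc (k n) * g n) → f ~ g
  ~-cancelˡ {f} {g} k kf~kg .eventually K = mapEventually
    (λ n le → *-cancelˡ-≤ (suc (k n)) (subst (_≤ suc (k n) * g n)
      (≡.sym (trans (*-comm-assoc (suc (k n)) K _) (cong (K *_) (*-distribˡ-∣-∣ (suc (k n)) (f n) (g n)))))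
      le))
    (kf~kg .eventually K)

  ~-shift : f ~ g → (λ n → f (suc n)) ~ (λ n → g (suc n))
  ~-shift f~g .eventually K = let N , close = f~g .eventually K in N , λ n N≤n → close (suc n) (m≤n⇒m≤1+n N≤n)

  ~-positive : f ~ g → (∀ n → 1 ≤ g n) → Positive f
  ~-positive {f} {g} f~g 1≤g = mapEventually
    (λ n le → n≢0⇒n>0 λ f≡0 → <⇒≱ (m<m+n (g n) (1≤g n))
      (subst (_≤ g n) (trans (cong (λ x → 2 * ∣ x - g n ∣) f≡0) (cong (_+_ (g n)) (+-identityʳ (g n)))) le))
    (f~g .eventually 2)

  ~-+-const : ∀ c → f ~ g → Unbounded g → (λ n → c + f n) ~ g
  ~-+-const {f} {g} c f~g unb .eventually K = zipEventually
    (λ n close big → *-triangle-≤ K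
      (subst (λ d → ∣ c + f n - g n ∣ ≤ d + ∣ f n - g n ∣)
        (trans (∣-∣-comm (c + f n) (f n)) (trans (cong (∣ f n -_∣) (+-comm c (f n))) (∣m-m+n∣≡n (f n) c)))
        (∣-∣-triangle (c + f n) (f n) (g n)))
      big close)
    (f~g .eventually (2 * K)) (unb (2 * K * c))

  -- Partial sums

  ∑ : (ℕ → ℕ) → ℕ → ℕ
  ∑ f n = sum (map f (upTo n))

  ∑-*ˡ : ∀ k f n → ∑ (λ i → k * f i) n ≡ k * ∑ f n
  ∑-*ˡ k f zero    = ≡.sym (*-zeroʳ k)
  ∑-*ˡ k f (suc n) = trans (sum-upTo-suc (λ i → k * f i) n) (trans (cong (_+ k * f n) (∑-*ˡ k f n))
    (trans (≡.sym (*-distribˡ-+ k (∑ f n) (f n))) (cong (k *_) (≡.sym (sum-upTo-suc f n)))))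

  ∑-shift : ∀ f n → f 0 + ∑ (λ i → f (suc i)) n ≡ ∑ f (suc n)
  ∑-shift f zero    = refl
  ∑-shift f (suc n) = trans (cong (f 0 +_) (sum-upTo-suc (λ i → f (suc i)) n))
    (trans (≡.sym (+-assoc (f 0) _ _)) (trans (cong (_+ f (suc n)) (∑-shift f n)) (≡.sym (sum-upTo-suc f (suc n)))))

  from-start : ∀ N (P : ℕ → Set) → (∀ k → P (N + k)) → ∀ n → N ≤ n → P n
  from-start N P p n N≤n = subst P (m+[n∸m]≡n N≤n) (p (n ∸ N))

  ∑-unbounded : Positive f → Unbounded (∑ f)
  ∑-unbounded {f} (N , pos) C = C + N , λ n le → ≤-trans (m+n≤o⇒m≤o∸n C le) (grows n (m+n≤o⇒n≤o C le))
    where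
    grows : ∀ n → N ≤ n → n ∸ N ≤ ∑ f n
    grows = from-start N (λ n → n ∸ N ≤ ∑ f n) λ k → subst (_≤ ∑ f (N + k)) (≡.sym (m+n∸m≡n N k)) (go k)
      where
      go : ∀ k → k ≤ ∑ f (N + k)
      go zero    = z≤n
      go (suc k) = subst₂ _≤_ (+-comm k 1) (trans (≡.sym (sum-upTo-suc f (N + k))) (cong (∑ f) (≡.sym (+-suc N k))))
        (+-mono-≤ (go k) (pos (N + k) (m≤m+n N k)))

  ∣-∣-+ : ∀ a b c d → ∣ a + c - b + d ∣ ≤ ∣ a - b ∣ + ∣ c - d ∣
  ∣-∣-+ a b c d = subst (∣ a + c - b + d ∣ ≤_)
    (cong₂ _+_ (trans (cong₂ ∣_-_∣ (+-comm a c) (+-comm b c)) (∣m+n-m+o∣≡∣n-o∣ c a b)) (∣m+n-m+o∣≡∣n-o∣ b c d))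
    (∣-∣-triangle (a + c) (b + c) (b + d))

  -- The discrepancy accumulated before N is a constant, which the unbounded sum of g eventually
  -- exceeds; from N on the errors are small term by term. Each source receives half of the
  -- precision.
  ∑-~ : f ~ g → Unbounded (∑ g) → ∑ f ~ ∑ g
  ∑-~ {f} {g} f~g unb .eventually K with f~g .eventually (2 * K)
  ... | N , close with unb (2 * K * ∣ ∑ f N - ∑ g N ∣)
  ...   | M , big = N ⊔ M , λ n le → *-cancelˡ-≤ 2 (begin
      2 * (K * ∣ ∑ f n - ∑ g n ∣)                    ≡⟨ *-assoc 2 K _ ⟨
      2 * K * ∣ ∑ f n - ∑ g n ∣                      ≤⟨ from-start N (λ n → 2 * K * ∣ ∑ f n - ∑ g n ∣ ≤ C + ∑ g n) go n (≤-trans (m≤m⊔n N M) le) ⟩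
      C + ∑ g n                                      ≤⟨ +-monoˡ-≤ (∑ g n) (big n (≤-trans (m≤n⊔m N M) le)) ⟩
      ∑ g n + ∑ g n                                  ≡⟨ cong (_+_ (∑ g n)) (+-identityʳ (∑ g n)) ⟨
      2 * ∑ g n                                      ∎)
    where
    open ≤-Reasoning
    C = 2 * K * ∣ ∑ f N - ∑ g N ∣
    go : ∀ k → 2 * K * ∣ ∑ f (N + k) - ∑ g (N + k) ∣ ≤ C + ∑ g (N + k)
    go zero    = subst (λ n → 2 * K * ∣ ∑ f n - ∑ g n ∣ ≤ C + ∑ g n) (≡.sym (+-identityʳ N)) (m≤m+n C _)
    go (suc k) = subst (λ n → 2 * K * ∣ ∑ f n - ∑ g n ∣ ≤ C + ∑ g n) (≡.sym (+-suc N k)) (begin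
      2 * K * ∣ ∑ f (suc n) - ∑ g (suc n) ∣                    ≡⟨ cong₂ (λ x y → 2 * K * ∣ x - y ∣) (sum-upTo-suc f n) (sum-upTo-suc g n) ⟩
      2 * K * ∣ ∑ f n + f n - ∑ g n + g n ∣                    ≤⟨ *-monoʳ-≤ (2 * K) (∣-∣-+ (∑ f n) (∑ g n) (f n) (g n)) ⟩
      2 * K * (∣ ∑ f n - ∑ g n ∣ + ∣ f n - g n ∣)              ≡⟨ *-distribˡ-+ (2 * K) _ _ ⟩
      2 * K * ∣ ∑ f n - ∑ g n ∣ + 2 * K * ∣ f n - g n ∣        ≤⟨ +-mono-≤ (go k) (close n (m≤m+n N k)) ⟩
      C + ∑ g n + g n                                          ≡⟨ +-assoc C _ _ ⟩
      C + (∑ g n + g n)                                        ≡⟨ cong (_+_ C) (sum-upTo-suc g n) ⟨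
      C + ∑ g (suc n)                                          ∎)
      where n = N + k

  -- Shifting the index turns the longer sum into `f 0` plus a sum of terms equivalent to q f; the
  -- unbounded sum absorbs the constant `f 0`.
  ∑-ratio : ∀ q → 1 ≤ q → (λ n → f (suc n)) ~ (λ n → q * f n) → Unbounded (∑ f) →
            (λ n → ∑ f (suc n)) ~ (λ n → q * ∑ f n)
  ∑-ratio {f} q 1≤q ratio unb = ~-trans {g = λ n → f 0 + ∑ (λ i → f (suc i)) n} (≗⇒~ (λ n → ≡.sym (∑-shift f n)))
    (~-+-const (f 0) (~-trans {g = ∑ (λ i → q * f i)} (∑-~ ratio unb∑) (≗⇒~ (∑-*ˡ q f))) unb*)
    where
    unb* : Unbounded (λ n → q * ∑ f n)
    unb* C = mapEventually
      (λ n big → ≤-trans big (subst (_≤ q * ∑ f n) (*-identityˡ (∑ f n)) (*-monoˡ-≤ (∑ f n) 1≤q))) (unb C)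
    unb∑ : Unbounded (∑ (λ n → q * f n))
    unb∑ C = mapEventually (λ n big → subst (C ≤_) (≡.sym (∑-*ˡ q f n)) big) (unb* C)

  -- Subtracting S from both sides keeps the error, but it must now be small against r S instead of
  -- (r + 1) S. For r ≥ 1 these differ by a factor of at most 2.
  remainder-close : ∀ K r x S → 1 ≤ r → 2 * K * ∣ S + x - suc r * S ∣ ≤ suc r * S → K * ∣ x - r * S ∣ ≤ r * S
  remainder-close K r x S 1≤r close = *-cancelˡ-≤ 2 (begin
    2 * (K * ∣ x - r * S ∣)           ≡⟨ *-assoc 2 K _ ⟨
    2 * K * ∣ x - r * S ∣             ≡⟨ cong (2 * K *_) (∣m+n-m+o∣≡∣n-o∣ S x (r * S)) ⟨
    2 * K * ∣ S + x - suc r * S ∣     ≤⟨ close ⟩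
    S + r * S                         ≤⟨ +-monoˡ-≤ (r * S) (subst (_≤ r * S) (*-identityˡ S) (*-monoˡ-≤ S 1≤r)) ⟩
    r * S + r * S                     ≡⟨ cong (_+_ (r * S)) (+-identityʳ (r * S)) ⟨
    2 * (r * S)                       ∎)
    where open ≤-Reasoning

  term~∑ : ∀ r → 1 ≤ r → (λ n → f (suc n)) ~ (λ n → suc r * f n) → Unbounded (∑ f) →
           f ~ (λ n → r * ∑ f n)
  term~∑ {f} r 1≤r ratio unb .eventually K = mapEventually
    (λ n close → remainder-close K r (f n) (∑ f n) 1≤r
      (subst (λ s → 2 * K * ∣ s - suc r * ∑ f n ∣ ≤ suc r * ∑ f n) (sum-upTo-suc f n) close))
    (∑-ratio (suc r) (s≤s z≤n) ratio unb .eventually (2 * K))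

  n<2^n : ∀ n → suc n ≤ 2 ^ n
  n<2^n zero    = ≤-refl
  n<2^n (suc n) = subst (suc (suc n) ≤_) (cong (2 ^ n +_) (≡.sym (+-identityʳ (2 ^ n))))
    (+-mono-≤ (m^n>0 2 n) (n<2^n n))

  n*[1+n]≤2^[1+n] : ∀ n → n * suc n ≤ 2 * 2 ^ n
  n*[1+n]≤2^[1+n] zero    = z≤n
  n*[1+n]≤2^[1+n] (suc n) = begin
    suc n * suc (suc n)           ≡⟨ solve 1 (λ n → (con 1 :+ n) :* (con 2 :+ n) := n :* (con 1 :+ n) :+ con 2 :* (con 1 :+ n)) refl n ⟩
    n * suc n + 2 * suc n         ≤⟨ +-mono-≤ (n*[1+n]≤2^[1+n] n) (*-monoʳ-≤ 2 (n<2^n n)) ⟩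
    2 * 2 ^ n + 2 * 2 ^ n         ≡⟨ cong (_+_ (2 * 2 ^ n)) (+-identityʳ (2 * 2 ^ n)) ⟨
    2 * (2 * 2 ^ n)               ∎
    where open ≤-Reasoning
          open +-*-Solver

  K*n≤2^n : ∀ K n → 2 * K ≤ n → K * n ≤ 2 ^ n
  K*n≤2^n K n 2K≤n = *-cancelˡ-≤ 2 (begin
    2 * (K * n)  ≡⟨ *-assoc 2 K n ⟨
    2 * K * n    ≤⟨ *-monoˡ-≤ n (m≤n⇒m≤1+n 2K≤n) ⟩
    suc n * n    ≡⟨ *-comm (suc n) n ⟩
    n * suc n    ≤⟨ n*[1+n]≤2^[1+n] n ⟩
    2 * 2 ^ n    ∎)
    where open ≤-Reasoning

  -- Growth of ℓ, L and Λ

  module Asymptotics (r : ℕ) where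

    q : ℕ
    q = 2 + r

    lyndon-~ : (λ i → suc i * ℓ q (suc i)) ~ (λ i → q ^ suc i)
    -- For m ≥ 8 K half of m is at least 4 K, as `K*n≤2^n` requires for the factor 2 K. Then 2^c,
    -- with c the larger half of m, absorbs K m and the two halves recombine to q^m.
    lyndon-~ .eventually K = 4 * K + 4 * K , λ i le → bound-at (suc i) (q^m≤ q i) (m≤n⇒m≤1+n le)
      where
      open ≤-Reasoning
      bound-at : ∀ m → q ^ m ≤ m * ℓ q m + m * q ^ ⌊ m /2⌋ → 4 * K + 4 * K ≤ m → K * ∣ m * ℓ q m - q ^ m ∣ ≤ q ^ m
      bound-at m upper le = begin
        K * ∣ m * ℓ q m - q ^ m ∣                ≡⟨ cong (K *_) (m≤n⇒∣m-n∣≡n∸m (m*ℓ≤q^m q m)) ⟩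
        K * (q ^ m ∸ m * ℓ q m)                  ≤⟨ *-monoʳ-≤ K (m≤n+o⇒m∸n≤o (q ^ m) (m * ℓ q m) upper) ⟩
        K * (m * q ^ ⌊ m /2⌋)                    ≤⟨ *-monoʳ-≤ K (*-monoˡ-≤ (q ^ ⌊ m /2⌋) m≤2c) ⟩
        K * (2 * c * q ^ ⌊ m /2⌋)                ≡⟨ solve 3 (λ K c x → K :* (con 2 :* c :* x) := x :* (con 2 :* K :* c)) refl K c (q ^ ⌊ m /2⌋) ⟩
        q ^ ⌊ m /2⌋ * (2 * K * c)                ≤⟨ *-monoʳ-≤ (q ^ ⌊ m /2⌋) (K*n≤2^n (2 * K) c 4K≤c) ⟩
        q ^ ⌊ m /2⌋ * 2 ^ c                      ≤⟨ *-monoʳ-≤ (q ^ ⌊ m /2⌋) (^-monoˡ-≤ c (s≤s (s≤s z≤n))) ⟩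
        q ^ ⌊ m /2⌋ * q ^ c                      ≡⟨ ^-distribˡ-+-* q ⌊ m /2⌋ c ⟨
        q ^ (⌊ m /2⌋ + c)                        ≡⟨ cong (q ^_) (⌊n/2⌋+⌈n/2⌉≡n m) ⟩
        q ^ m                                    ∎
        where
        open +-*-Solver
        c = ⌈ m /2⌉
        m≤2c : m ≤ 2 * c
        m≤2c = begin
          m                ≡⟨ ⌊n/2⌋+⌈n/2⌉≡n m ⟨
          ⌊ m /2⌋ + c      ≤⟨ +-monoˡ-≤ c (⌊n/2⌋≤⌈n/2⌉ m) ⟩
          c + c            ≡⟨ cong (_+_ c) (+-identityʳ c) ⟨
          2 * c            ∎
        4K≤c : 2 * (2 * K) ≤ c
        4K≤c = begin
          2 * (2 * K)              ≡⟨ *-assoc 2 2 K ⟨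
          4 * K                    ≡⟨ n≡⌈n+n/2⌉ (4 * K) ⟩
          ⌈ 4 * K + 4 * K /2⌉      ≤⟨ ⌈n/2⌉-mono le ⟩
          c                        ∎

    suc-~ : ∀ (k : ℕ → ℕ) → (λ i → suc i * k i) ~ (λ i → suc (suc i) * k i)
    suc-~ k .eventually K = K , λ i le → subst (λ d → K * d ≤ suc (suc i) * k i)
      (≡.sym (trans (cong (∣ suc i * k i -_∣) (+-comm (k i) (suc i * k i))) (∣m-m+n∣≡n (suc i * k i) (k i))))
      (*-monoˡ-≤ (k i) (m≤n⇒m≤1+n (m≤n⇒m≤1+n le)))

    -- In the chain (m + 1) ℓ_{m+1} ~ q^{m+1} = q q^m ~ q m ℓ_m ~ (m + 1) q ℓ_m the factor m + 1
    -- cancels.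
    ℓ-ratio : (λ i → ℓ q (suc (suc i))) ~ (λ i → q * ℓ q (suc i))
    ℓ-ratio = ~-cancelˡ suc
      (~-trans (~-shift lyndon-~)
      (~-trans (~-*ˡ (λ _ → q) (~-sym lyndon-~))
      (~-trans (≗⇒~ λ i → *-comm-assoc q (suc i) (ℓ q (suc i)))
      (suc-~ (λ i → q * ℓ q (suc i))))))

    ℓ-positive : Positive (λ i → ℓ q (suc i))
    ℓ-positive = mapEventually
      (λ n pos → n≢0⇒n>0 λ ℓ≡0 → contradiction (trans (cong (suc n *_) ℓ≡0) (*-zeroʳ (suc n))) (m<n⇒n≢0 pos))
      (~-positive lyndon-~ (λ n → m^n>0 q (suc n)))

    L-ratio : (λ n → L q (suc n)) ~ (λ n → q * L q n)
    L-ratio = ∑-ratio q (s≤s z≤n) ℓ-ratio (∑-unbounded ℓ-positive)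

    ℓ~L : (λ n → ℓ q (suc n)) ~ (λ n → suc r * L q n)
    ℓ~L = term~∑ (suc r) (s≤s z≤n) ℓ-ratio (∑-unbounded ℓ-positive)

    L-positive : Positive (λ i → L q (suc i))
    L-positive = mapEventually
      (λ n pos → subst (1 ≤_) (≡.sym (sum-upTo-suc (λ i → ℓ q (suc i)) n)) (≤-trans pos (m≤n+m _ _))) ℓ-positive

    L~Λ : (λ n → L q (suc n)) ~ (λ n → suc r * Λ q n)
    L~Λ = term~∑ (suc r) (s≤s z≤n) (~-shift L-ratio) (∑-unbounded L-positive)

    Λ~ℓ : (λ n → suc r * (suc r * Λ q n)) ~ (λ n → q * ℓ q (suc n))
    Λ~ℓ = ~-trans (~-*ˡ (λ _ → suc r) (~-sym L~Λ))
      (~-trans (~-*ˡ (λ _ → suc r) L-ratio)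
      (~-trans (≗⇒~ λ n → *-comm-assoc (suc r) q (L q n))
      (~-*ˡ (λ _ → q) (~-sym ℓ~L))))

  -- The limit in the rational numbers

  ∣⊖∣≡∣-∣ : ∀ m n → ℤ.∣ m ℤ.⊖ n ∣ ≡ ∣ m - n ∣
  ∣⊖∣≡∣-∣ m n with ≤-total m n
  ... | inj₁ m≤n = trans (ℤ.∣⊖∣-≤ m≤n) (≡.sym (m≤n⇒∣m-n∣≡n∸m m≤n))
  ... | inj₂ n≤m = trans (ℤ.∣m⊖n∣≡∣n⊖m∣ m n) (trans (ℤ.∣⊖∣-≤ n≤m) (≡.sym (m≤n⇒∣n-m∣≡n∸m n≤m)))

  1+frac : ∀ c d → 1ℚ ℚ.+ frac c (suc d) ≡ frac (suc d + c) (suc d)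
  1+frac c d = ℚ.toℚᵘ-injective (ℚᵘ.≃-trans (ℚ.toℚᵘ-homo-+ 1ℚ (frac c (suc d)))
    (ℚᵘ.≃-trans (ℚᵘ.+-congʳ ℚᵘ.1ℚᵘ (ℚ.toℚᵘ-fromℚᵘ (mkℚᵘ (ℤ.+ c) d)))
    (ℚᵘ.≃-trans (*≡* (cong₂ ℤ._*_ numerator≡ denominator≡)) (ℚᵘ.≃-sym (ℚ.toℚᵘ-fromℚᵘ (mkℚᵘ (ℤ.+ (suc d + c)) d))))))
    where
    numerator≡ : ℤ.+ 1 ℤ.* ℤ.+ suc d ℤ.+ ℤ.+ c ℤ.* ℤ.+ 1 ≡ ℤ.+ (suc d + c)
    numerator≡ = trans (cong₂ ℤ._+_ (ℤ.*-identityˡ (ℤ.+ suc d)) (ℤ.*-identityʳ (ℤ.+ c))) (≡.sym (ℤ.pos-+ (suc d) c))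
    denominator≡ : ℤ.+ suc d ≡ ℤ.+ suc (d + 0)
    denominator≡ = cong (λ k → ℤ.+ suc k) (≡.sym (+-identityʳ d))

  -- A positive ε is at least the reciprocal of its denominator, so closeness to within that
  -- reciprocal suffices, after multiplying out.
  frac-close : ∀ a b c d ε → 0ℚ ℚ.< ε → ℚ.↧ₙ ε * ∣ a * suc d - c * suc b ∣ < suc b * suc d →
               ℚ.∣ frac a (suc b) ℚ.- frac c (suc d) ∣ ℚ.< ε
  frac-close a b c d ε@(mkℚ (ℤ.+ zero) _ _)  (ℚ.*<* (ℤ.+<+ ())) _
  frac-close a b c d ε@(mkℚ (ℤ.+ suc p) e _) _ close = ℚ.toℚᵘ-cancel-< (ℚᵘ.<-respˡ-≃ (ℚᵘ.≃-sym simplify)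
    (*<* (subst₂ ℤ._<_ (ℤ.pos-* diff (suc e)) (ℤ.pos-* (suc p) (suc b * suc d)) (ℤ.+<+ close′))))
    where
    diff = ℤ.∣ ℤ.+ a ℤ.* ℤ.+ suc d ℤ.+ ℤ.- (ℤ.+ c) ℤ.* ℤ.+ suc b ∣
    x = mkℚᵘ (ℤ.+ a) b
    y = mkℚᵘ (ℤ.+ c) d
    simplify : toℚᵘ ℚ.∣ frac a (suc b) ℚ.- frac c (suc d) ∣ ≃ ℚᵘ.∣ x ℚᵘ.- y ∣
    simplify = ℚᵘ.≃-trans (ℚ.toℚᵘ-homo-∣-∣ (frac a (suc b) ℚ.- frac c (suc d))) (ℚᵘ.∣-∣-cong
      (ℚᵘ.≃-trans (ℚ.toℚᵘ-homo-+ (frac a (suc b)) (ℚ.- frac c (suc d)))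
      (ℚᵘ.+-cong (ℚ.toℚᵘ-fromℚᵘ x) (ℚᵘ.≃-trans (ℚ.toℚᵘ-homo‿- (frac c (suc d))) (ℚᵘ.-‿cong (ℚ.toℚᵘ-fromℚᵘ y))))))
    numerator≡ : diff ≡ ∣ a * suc d - c * suc b ∣
    numerator≡ = trans (cong ℤ.∣_∣ (trans (cong₂ ℤ._+_ (≡.sym (ℤ.pos-* a (suc d)))
        (trans (≡.sym (ℤ.neg-distribˡ-* (ℤ.+ c) (ℤ.+ suc b))) (cong ℤ.-_ (≡.sym (ℤ.pos-* c (suc b))))))
        (ℤ.m-n≡m⊖n (a * suc d) (c * suc b))))
      (∣⊖∣≡∣-∣ (a * suc d) (c * suc b))
    close′ : diff * suc e < suc p * (suc b * suc d)
    close′ = begin-strict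
      diff * suc e                       ≡⟨ cong (_* suc e) numerator≡ ⟩
      ∣ a * suc d - c * suc b ∣ * suc e  ≡⟨ *-comm _ (suc e) ⟩
      suc e * ∣ a * suc d - c * suc b ∣  <⟨ close ⟩
      suc b * suc d                      ≤⟨ m≤n*m (suc b * suc d) (suc p) ⟩
      suc p * (suc b * suc d)            ∎
      where open ≤-Reasoning

  -- Over the common denominator the fractions differ by 3 |(q - 1)² Λ′ - q l|. The factor q in the
  -- precision cancels against q l, the 3 is this numerator factor, and the 2 turns ≤ into < because
  -- l ≥ 1.
  ratio-close : ∀ r Λ′ l ε → let q = 2 + r; K = 2 * (3 * ℚ.↧ₙ ε) in 0ℚ ℚ.< ε → 1 ≤ l →
    q * K * ∣ suc r * (suc r * Λ′) - q * l ∣ ≤ q * l →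
    ℚ.∣ frac (3 * Λ′ + l) l ℚ.- (1ℚ ℚ.+ frac (3 * q) (suc r ^ 2)) ∣ ℚ.< ε
  ratio-close r Λ′ l@(suc b) ε 0<ε 1≤l close = subst (λ y → ℚ.∣ frac (3 * Λ′ + l) l ℚ.- y ∣ ℚ.< ε)
    (≡.sym (1+frac (3 * q) d))
    (frac-close (3 * Λ′ + l) b (s + 3 * q) d ε 0<ε (begin-strict
      D * ∣ (3 * Λ′ + l) * s - (s + 3 * q) * l ∣             ≡⟨ cong (D *_) (cong₂ ∣_-_∣ eq₁ eq₂) ⟩
      D * ∣ l * s + 3 * (t * (t * Λ′)) - l * s + 3 * (q * l) ∣ ≡⟨ cong (D *_) (∣m+n-m+o∣≡∣n-o∣ (l * s) _ _) ⟩
      D * ∣ 3 * (t * (t * Λ′)) - 3 * (q * l) ∣               ≡⟨ cong (D *_) (*-distribˡ-∣-∣ 3 (t * (t * Λ′)) (q * l)) ⟨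
      D * (3 * e)                                            ≡⟨ trans (*-comm-assoc D 3 e) (≡.sym (*-assoc 3 D e)) ⟩
      3 * D * e                                              <⟨ ≰⇒> (λ l≤ → <⇒≱ (m<m+n l 1≤l) (≤-trans (+-mono-≤ l≤ l≤) twice≤)) ⟩
      l                                                      ≤⟨ m≤m*n l s ⟩
      l * s                                                  ∎))
    where
    open ≤-Reasoning
    open +-*-Solver
    q = 2 + r
    t = 1 + r
    s = suc r ^ 2
    -- The predecessor of (r + 1)² in the form to which `suc r ^ 2` computes, so that `frac`
    -- reduces.
    d = r * 1 + r * (suc r * 1)
    D = ℚ.↧ₙ ε
    e = ∣ t * (t * Λ′) - q * l ∣
    eq₁ : (3 * Λ′ + l) * s ≡ l * s + 3 * (t * (t * Λ′))
    eq₁ = solve 3 (λ x l t → (con 3 :* x :+ l) :* (t :* (t :* con 1)) 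
      := l :* (t :* (t :* con 1)) :+ con 3 :* (t :* (t :* x))) refl Λ′ l t
    eq₂ : (s + 3 * q) * l ≡ l * s + 3 * (q * l)
    eq₂ = solve 3 (λ s q l → (s :+ con 3 :* q) :* l := l :* s :+ con 3 :* (q :* l)) refl s q l
    twice≤ : 3 * D * e + 3 * D * e ≤ l
    twice≤ = *-cancelˡ-≤ q (begin
      q * (3 * D * e + 3 * D * e)  ≡⟨ solve 3 (λ q x e → q :* (x :* e :+ x :* e) := q :* (con 2 :* x) :* e) refl q (3 * D) e ⟩
      q * (2 * (3 * D)) * e        ≤⟨ close ⟩
      q * l                        ∎)

  amortized-limit : (q : ℕ) → 2 ≤ q → (ε : ℚ) → 0ℚ ℚ.< ε → Eventually λ n →
    ℚ.∣ frac (bound q n) (ℓ q n) ℚ.- (1ℚ ℚ.+ frac (3 * q) ((q ∸ 1) ^ 2)) ∣ ℚ.< ε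
  amortized-limit q@(suc (suc r)) (s≤s (s≤s z≤n)) ε 0<ε = unshiftEventually (zipEventually
    (λ n close pos →
      subst (λ x → ℚ.∣ frac (3 * x + ℓ q (suc n)) (ℓ q (suc n)) ℚ.- (1ℚ ℚ.+ frac (3 * q) (suc r ^ 2)) ∣ ℚ.< ε)
        (≡.sym (Λ-suc∸L q n)) (ratio-close r (Λ q n) (ℓ q (suc n)) ε 0<ε pos close))
    (Asymptotics.Λ~ℓ r .eventually (q * (2 * (3 * ℚ.↧ₙ ε)))) (Asymptotics.ℓ-positive r))

open import Data.Rational using (_+_; _-_; ∣_∣; _<_)

theorem4 : (q : ℕ) → 2 ≤ q →
    ((n : ℕ) → 1 ≤ n →
    Σ (List (Word q)) λ ws → Σ (List (List (Update q))) λ us →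
    All (λ w → length w ≡ n × Lyndon w) ws
    × ((w : Word q) → length w ≡ n → Lyndon w → w ∈ ws)
    × Linked _<lex_ ws
    × Steps ws us
    × totalUpdates us ≤ bound q n)
    × ((ε : ℚ) → 0ℚ < ε → ∃ λ N → (n : ℕ) → N ≤ n →
    ∣ frac (bound q n) (ℓ q n) - (1ℚ + frac (3 * q) ((q ∸ 1) ^ 2)) ∣ < ε)
theorem4 q 2≤q = Enumeration.enumerate q , Limits.amortized-limit q 2≤q
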